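{- There exists a $2$-approximation algorithm for the min latency set cover problem. That is, there is a randomized polynomial-time algorithm which, given any finite hypergraph $(V,E)$, outputs an ordering $\sigma$ of $V$ such that $$\mathbb{E}\Big[\sum_{e\in E}\mathrm{Cov}_\sigma(e)\Big]\le 2\cdot\min_{\pi}\sum_{e\in E}\mathrm{Cov}_\pi(e),$$ where the minimum is over all orderings $\pi$ of $V$.
   Context: Min latency set cover: the input is a finite hypergraph $(V,E)$ on $n$ vertices (hyperedges are nonempty subsets of $V$). An ordering (schedule) of $V$ is a bijection $\pi:\{1,\dots,n\}\to V$, with $\pi(t)$ the vertex scheduled at time $t$. The cover time $\mathrm{Cov}_\pi(e)$ of a hyperedge $e$ is the earliest time $t$ such that all $|e|$ vertices of $e$ are among $\pi(1),\dots,\pi(t)$. The objective is to find an ordering minimizing $\sum_{e\in E}\mathrm{Cov}_\pi(e)$. -}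

module Defs where

open import Data.Bool.Base using (Bool; true; false)
open import Data.Nat.Base using (ℕ; zero; suc; _+_; _*_; _^_; _≤_; z≤n; s≤s)
open import Data.Nat.Properties using (≤-refl; ≤-trans; ≤-antisym; ≤-total; ≤-reflexive; _≤?_)
open import Data.Fin.Base using (Fin; zero; suc; toℕ; punchIn)
open import Data.Fin.Properties using (any?; all?; _≟_; toℕ<n)
open import Data.Fin.Permutation using
  (Permutation′; _⟨$⟩ʳ_; _⟨$⟩ˡ_; _≈_; id; insert; remove; insert-punchIn; insert-remove; inverseʳ)
open import Data.Fin.Subset using (Subset; Nonempty; _∈_)
open import Data.Fin.Subset.Properties using (_∈?_)
open import Data.List.Base as List using (List; []; _∷_)
open import Data.List.Relation.Unary.All using (All)
open import Data.List.Relation.Unary.Unique.Propositional using (Unique)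
open import Data.List.Properties using (map-cong)
open import Data.Nat.ListAction using (sum)
open import Data.Vec.Base as Vec using (Vec; []; _∷_)
open import Data.Product.Base using (∃; ∃-syntax; Σ-syntax; _×_; _,_; proj₁; proj₂)
open import Data.Sum.Base using (inj₁; inj₂)
open import Data.Integer.Base using (+_)
open import Data.Rational.Base as ℚ using (ℚ; ½)
open import Relation.Nullary using (yes; no; contradiction)
open import Relation.Nullary.Decidable using (_×-dec_; _→-dec_)
open import Relation.Unary using (Pred; Decidable)
open import Relation.Binary.PropositionalEquality
  using (_≡_; refl; sym; trans; cong; _≗_)
open import Level using (0ℓ)

IsLeast : Pred ℕ 0ℓ → Pred ℕ 0ℓ
IsLeast P t = P t × (∀ s → P s → t ≤ s)

least : {P : Pred ℕ 0ℓ} → Decidable P → ∀ w → P w → ∃ (IsLeast P)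
least P? zero    p = zero , p , λ _ _ → z≤n
least {P} P? (suc w) p with P? zero
... | yes p₀ = zero , p₀ , λ _ _ → z≤n
... | no ¬p₀ with least (λ t → P? (suc t)) w p
...   | t , pt , t≤ = suc t , pt , bound
  where
  bound : ∀ s → P s → suc t ≤ s
  bound zero    p₀ = contradiction p₀ ¬p₀
  bound (suc s) ps = s≤s (t≤ s ps)

IsMinimumOf : {A : Set} → (A → ℕ) → Pred ℕ 0ℓ
IsMinimumOf f m = (∃[ a ] f a ≡ m) × (∀ a → m ≤ f a)

minimumFin : ∀ {n} (f : Fin (suc n) → ℕ) → ∃ (IsMinimumOf f)
minimumFin {zero}  f = f zero , (zero , refl) , λ { zero → ≤-refl }
minimumFin {suc n} f with minimumFin (λ i → f (suc i))
... | m , (i , fi≡m) , m≤ with ≤-total (f zero) m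
...   | inj₁ f0≤m = f zero , (zero , refl) ,
                    λ { zero → ≤-refl ; (suc j) → ≤-trans f0≤m (m≤ j) }
...   | inj₂ m≤f0 = m , (suc i , fi≡m) , λ { zero → m≤f0 ; (suc j) → m≤ j }

-- The vertex set is Fin n.  The edge set is listed without repetition, in an
-- arbitrary order.
record Hypergraph : Set where
  field
    n        : ℕ
    edges    : List (Subset n)
    nonempty : All Nonempty edges
    distinct : Unique edges

open Hypergraph public

-- π ⟨$⟩ʳ i is the vertex scheduled at time suc (toℕ i).
Ordering : ℕ → Set
Ordering = Permutation′

module _ {n : ℕ} where

  ScheduledBy : Ordering n → ℕ → Fin n → Set
  ScheduledBy π t v = ∃[ i ] (π ⟨$⟩ʳ i ≡ v) × (suc (toℕ i) ≤ t)

  CoveredBy : Ordering n → Subset n → ℕ → Set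
  CoveredBy π e t = ∀ v → v ∈ e → ScheduledBy π t v

  coveredBy? : ∀ π e → Decidable (CoveredBy π e)
  coveredBy? π e t = all? λ v → (v ∈? e) →-dec
    any? λ i → ((π ⟨$⟩ʳ i) ≟ v) ×-dec (suc (toℕ i) ≤? t)

  coveredBy-n : ∀ π e → CoveredBy π e n
  coveredBy-n π e v _ = π ⟨$⟩ˡ v , inverseʳ π , toℕ<n _

  earliest : ∀ π e → ∃ (IsLeast (CoveredBy π e))
  earliest π e = least (coveredBy? π e) n (coveredBy-n π e)

  Cov : Ordering n → Subset n → ℕ
  Cov π e = proj₁ (earliest π e)

  coveredBy-cong : ∀ {π ρ : Ordering n} → π ≈ ρ → ∀ {e t} →
                   CoveredBy π e t → CoveredBy ρ e t
  coveredBy-cong π≈ρ c v v∈e with c v v∈e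
  ... | i , πi≡v , i<t = i , trans (sym (π≈ρ i)) πi≡v , i<t

  Cov-cong : ∀ {π ρ : Ordering n} → π ≈ ρ → Cov π ≗ Cov ρ
  Cov-cong {π} {ρ} π≈ρ e with earliest π e | earliest ρ e
  ... | s , cs , s≤ | t , ct , t≤ = ≤-antisym
    (s≤ t (coveredBy-cong {ρ} {π} (λ i → sym (π≈ρ i)) ct))
    (t≤ s (coveredBy-cong {π} {ρ} π≈ρ cs))

latency : (H : Hypergraph) → Ordering (n H) → ℕ
latency H π = sum (List.map (Cov π) (edges H))

latency-cong : ∀ H {π ρ : Ordering (n H)} → π ≈ ρ → latency H π ≡ latency H ρ
latency-cong H {π} {ρ} π≈ρ =
  cong sum (map-cong (Cov-cong {π = π} {ρ} π≈ρ) (edges H))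

insert-cong : ∀ {n} (j : Fin (suc n)) {π ρ : Ordering n} → π ≈ ρ →
              insert zero j π ≈ insert zero j ρ
insert-cong j π≈ρ zero = refl
insert-cong j {π} {ρ} π≈ρ (suc k) =
  trans (insert-punchIn zero j π k)
    (trans (cong (punchIn j) (π≈ρ k)) (sym (insert-punchIn zero j ρ k)))

minimumOrdering : ∀ n (f : Ordering n → ℕ) →
                  (∀ {π ρ} → π ≈ ρ → f π ≡ f ρ) → ∃ (IsMinimumOf f)
minimumOrdering zero    f f-cong =
  f id , (id , refl) , λ π → ≤-reflexive (f-cong {id} {π} λ ())
minimumOrdering (suc n) f f-cong = attained
  where
  sub : ∀ j → ∃ (IsMinimumOf (λ π → f (insert zero j π)))
  sub j = minimumOrdering n (λ π → f (insert zero j π))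
    λ {π} {ρ} π≈ρ → f-cong {insert zero j π} {insert zero j ρ}
                           (insert-cong j {π} {ρ} π≈ρ)

  attained : ∃ (IsMinimumOf f)
  attained with minimumFin (λ j → proj₁ (sub j))
  ... | m , (j , mj≡m) , m≤ with proj₁ (proj₂ (sub j))
  ...   | π , fπ≡mj = m , (insert zero j π , trans fπ≡mj mj≡m) , λ ρ →
    ≤-trans (m≤ (ρ ⟨$⟩ʳ zero))
      (≤-trans (proj₂ (proj₂ (sub (ρ ⟨$⟩ʳ zero))) (remove zero ρ))
        (≤-reflexive (f-cong {insert zero (ρ ⟨$⟩ʳ zero) (remove zero ρ)} {ρ}
                             (insert-remove zero ρ))))

optimum : ∀ H → ∃ (IsMinimumOf (latency H))
optimum H = minimumOrdering (n H) (latency H)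
              (λ {π} {ρ} → latency-cong H {π} {ρ})

minLatency : Hypergraph → ℕ
minLatency H = proj₁ (optimum H)

-- The machine model is a first-order call-by-value functional language with
-- recursion over binary trees (in the style of Jones, "Computability and
-- Complexity: From a Programming Perspective"), extended with a fair coin.
-- The cost of a run is the number of evaluation rules applied.  Representing
-- trees by pointers with sharing, each rule takes a constant (depending only
-- on the program) number of pointer operations and allocates at most one new
-- node, so polynomially many rules amount to polynomial time on a
-- probabilistic Turing machine, and conversely.

data Tree : Set where
  nil : Tree
  _∙_ : Tree → Tree → Tree

infixr 5 _∙_

size : Tree → ℕ
size nil     = 1
size (x ∙ y) = suc (size x + size y)

-- Expressions over m globally defined functions, with Γ variables in scope
-- (de Bruijn indices).
data Expr {m : ℕ} (arity : Fin m → ℕ) (Γ : ℕ) : Set where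
  var    : Fin Γ → Expr arity Γ
  nil    : Expr arity Γ
  cons   : Expr arity Γ → Expr arity Γ → Expr arity Γ
  match  : Expr arity Γ → Expr arity Γ → Expr arity (suc (suc Γ)) → Expr arity Γ
  let′   : Expr arity Γ → Expr arity (suc Γ) → Expr arity Γ
  call   : (f : Fin m) → Vec (Expr arity Γ) (arity f) → Expr arity Γ
  coin   : Expr arity Γ

record Program : Set where
  field
    m     : ℕ
    arity : Fin m → ℕ
    body  : (f : Fin m) → Expr arity (arity f)
    main  : Expr arity 1

encodeBool : Bool → Tree
encodeBool false = nil
encodeBool true  = nil ∙ nil

module Semantics (P : Program) where
  open Program P

  private variable
    Γ k : ℕ
    ρ : Vec Tree Γ
    ω ω₁ ω₂ ω₃ : List Bool
    s t : ℕ
    u v x y : Tree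
    vs : Vec Tree k
    a b c : Expr arity Γ
    as : Vec (Expr arity Γ) k

  -- ρ , ω ⊢ a ⇓[ t ] v , ω′ : in environment ρ, with coin flips still to be
  -- read ω, the expression a evaluates in t steps to v, leaving the flips ω′.
  -- There is no rule for coin on an exhausted list.
  infix 3 _,_⊢_⇓[_]_,_ _,_⊢_⇓*[_]_,_

  data _,_⊢_⇓[_]_,_ : Vec Tree Γ → List Bool → Expr arity Γ → ℕ →
                      Tree → List Bool → Set
  data _,_⊢_⇓*[_]_,_ : Vec Tree Γ → List Bool → Vec (Expr arity Γ) k → ℕ →
                       Vec Tree k → List Bool → Set

  data _,_⊢_⇓[_]_,_ where
    ⇓var : ∀ {i} → ρ , ω ⊢ var i ⇓[ 1 ] Vec.lookup ρ i , ω
    ⇓nil : ρ , ω ⊢ nil ⇓[ 1 ] nil , ω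
    ⇓cons : ρ , ω₁ ⊢ a ⇓[ s ] u , ω₂ →
            ρ , ω₂ ⊢ b ⇓[ t ] v , ω₃ →
            ρ , ω₁ ⊢ cons a b ⇓[ suc (s + t) ] u ∙ v , ω₃
    ⇓match-nil : ρ , ω₁ ⊢ a ⇓[ s ] nil , ω₂ →
                 ρ , ω₂ ⊢ b ⇓[ t ] v , ω₃ →
                 ρ , ω₁ ⊢ match a b c ⇓[ suc (s + t) ] v , ω₃
    ⇓match-cons : ρ , ω₁ ⊢ a ⇓[ s ] x ∙ y , ω₂ →
                  x ∷ y ∷ ρ , ω₂ ⊢ c ⇓[ t ] v , ω₃ →
                  ρ , ω₁ ⊢ match a b c ⇓[ suc (s + t) ] v , ω₃
    ⇓let : ρ , ω₁ ⊢ a ⇓[ s ] u , ω₂ →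
           u ∷ ρ , ω₂ ⊢ b ⇓[ t ] v , ω₃ →
           ρ , ω₁ ⊢ let′ a b ⇓[ suc (s + t) ] v , ω₃
    ⇓call : ∀ {f as} {vs : Vec Tree (arity f)} →
            ρ , ω₁ ⊢ as ⇓*[ s ] vs , ω₂ →
            vs , ω₂ ⊢ body f ⇓[ t ] v , ω₃ →
            ρ , ω₁ ⊢ call f as ⇓[ suc (s + t) ] v , ω₃
    ⇓coin : ∀ {h} → ρ , h ∷ ω ⊢ coin ⇓[ 1 ] encodeBool h , ω

  data _,_⊢_⇓*[_]_,_ where
    ⇓[] : ρ , ω ⊢ [] ⇓*[ 0 ] [] , ω
    ⇓∷  : ρ , ω₁ ⊢ a ⇓[ s ] v , ω₂ →
          ρ , ω₂ ⊢ as ⇓*[ t ] vs , ω₃ →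
          ρ , ω₁ ⊢ a ∷ as ⇓*[ s + t ] v ∷ vs , ω₃

  deterministic : ∀ {a : Expr arity Γ} {s t u v ω₁ ω₂} →
    ρ , ω ⊢ a ⇓[ s ] u , ω₁ → ρ , ω ⊢ a ⇓[ t ] v , ω₂ →
    s ≡ t × u ≡ v × ω₁ ≡ ω₂
  deterministic* : ∀ {as : Vec (Expr arity Γ) k} {s t us vs ω₁ ω₂} →
    ρ , ω ⊢ as ⇓*[ s ] us , ω₁ → ρ , ω ⊢ as ⇓*[ t ] vs , ω₂ →
    s ≡ t × us ≡ vs × ω₁ ≡ ω₂

  deterministic ⇓var ⇓var = refl , refl , refl
  deterministic ⇓nil ⇓nil = refl , refl , refl
  deterministic (⇓cons p q) (⇓cons p′ q′) with deterministic p p′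
  ... | refl , refl , refl with deterministic q q′
  ...   | refl , refl , refl = refl , refl , refl
  deterministic (⇓match-nil p q) (⇓match-nil p′ q′) with deterministic p p′
  ... | refl , refl , refl with deterministic q q′
  ...   | refl , refl , refl = refl , refl , refl
  deterministic (⇓match-nil p q) (⇓match-cons p′ q′) with deterministic p p′
  ... | _ , () , _
  deterministic (⇓match-cons p q) (⇓match-nil p′ q′) with deterministic p p′
  ... | _ , () , _
  deterministic (⇓match-cons p q) (⇓match-cons p′ q′) with deterministic p p′
  ... | refl , refl , refl with deterministic q q′
  ...   | refl , refl , refl = refl , refl , refl
  deterministic (⇓let p q) (⇓let p′ q′) with deterministic p p′
  ... | refl , refl , refl with deterministic q q′
  ...   | refl , refl , refl = refl , refl , refl
  deterministic (⇓call p q) (⇓call p′ q′) with deterministic* p p′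
  ... | refl , refl , refl with deterministic q q′
  ...   | refl , refl , refl = refl , refl , refl
  deterministic ⇓coin ⇓coin = refl , refl , refl

  deterministic* ⇓[] ⇓[] = refl , refl , refl
  deterministic* (⇓∷ p q) (⇓∷ p′ q′) with deterministic p p′
  ... | refl , refl , refl with deterministic* q q′
  ...   | refl , refl , refl = refl , refl , refl

-- On the given input and coin flips, P halts with the given output after at
-- most T steps.
Outputs : Program → Tree → List Bool → ℕ → Tree → Set
Outputs P input ω T output =
  ∃[ t ] ∃[ ω′ ] (t ≤ T) × (input ∷ [] , ω ⊢ main ⇓[ t ] output , ω′)
  where
  open Program P using (main)
  open Semantics P

encodeList : List Tree → Tree
encodeList = List.foldr _∙_ nil

encodeℕ : ℕ → Tree
encodeℕ k = encodeList (List.replicate k nil)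

encodeSubset : ∀ {n} → Subset n → Tree
encodeSubset e = encodeList (List.map encodeBool (Vec.toList e))

-- The number of vertices in unary, followed by the incidence vectors of the
-- edges; up to a polynomial this has the size of any explicit listing of V, E.
encodeHypergraph : Hypergraph → Tree
encodeHypergraph H = encodeℕ (n H) ∙ encodeList (List.map encodeSubset (edges H))

-- The list π(1), …, π(n), with vertices numbered from 0.
encodeOrdering : ∀ {n} → Ordering n → Tree
encodeOrdering π = encodeList (List.tabulate λ i → encodeℕ (toℕ (π ⟨$⟩ʳ i)))

𝔼 : ∀ {k} → (Vec Bool k → ℚ) → ℚ
𝔼 {zero}  X = X []
𝔼 {suc k} X = ½ ℚ.* (𝔼 (λ ω → X (false ∷ ω)) ℚ.+ 𝔼 (λ ω → X (true ∷ ω)))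

fromℕ : ℕ → ℚ
fromℕ k = + k ℚ./ 1

-- P runs in polynomial time and has expected approximation ratio at most r.
-- A run of at most T steps flips at most T coins, so its behaviour is
-- determined by T flips; σ ω is the ordering output on the flips ω, unique up
-- to _≈_ by determinism of the semantics.
IsRandomizedPolytimeApproximation : ℚ → Program → Set
IsRandomizedPolytimeApproximation r P =
  Σ[ c ∈ ℕ ] Σ[ d ∈ ℕ ] ∀ (H : Hypergraph) →
    let input = encodeHypergraph H
        T     = c * size input ^ d + c
    in Σ[ σ ∈ (Vec Bool T → Ordering (n H)) ]
         (∀ ω → Outputs P input (Vec.toList ω) T (encodeOrdering (σ ω)))
         × 𝔼 (λ ω → fromℕ (latency H (σ ω))) ℚ.≤ r ℚ.* fromℕ (minLatency H)

{-# OPTIONS --safe #-}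
-- Take N = n² copies ("units") of every edge and charge each unit to a vertex of
-- its edge.  While some unit can move to a vertex of its edge whose load is
-- smaller by at least 2, move it; the sum of the squared loads drops.  Output the
-- vertices by decreasing load L.
--
-- For every ordering π, N times its latency is at least the sum of L v · pos v.
-- Expanding pos v as a count of the vertices up to v turns twice this sum into
-- one over pairs of vertices, whence
--   2 N · latency π ≥ Σ_v L v + Σ_{v,w} min (L v) (L w).
-- In the output σ, when an edge with a unit on v is covered, only vertices w with
-- L v ≤ L w + 1 have been scheduled, so
--   N · latency σ ≤ Σ_{v,w} [L v ≤ L w + 1] L v ≤ Σ_{v,w} min (L v) (L w) + n².
-- Since Σ_v L v = N |E| ≥ n² unless E is empty, latency σ ≤ 2 · latency π.
module Submission where

open import Defs
open import Data.Product.Base using (Σ-syntax)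
open import Data.Bool.Base using (Bool; true; false; if_then_else_; T)
open import Data.Nat.Base hiding (Ordering; less; equal; greater)
open import Data.Nat.Properties hiding (_≟_)
open import Data.Nat.Solver using (module +-*-Solver)
open import Data.Nat.ListAction using (sum)
open import Data.Nat.ListAction.Properties using (sum-++)
import Data.Integer.Base as ℤ
import Data.Integer.Properties as ℤ
open import Data.Rational.Base as ℚ using (½)
import Data.Rational.Properties as ℚ
open import Data.Rational.Unnormalised.Base as ℚᵘ using (mkℚᵘ; *≤*)
import Data.Rational.Unnormalised.Properties as ℚᵘ
open import Data.Fin.Base using (Fin; zero; suc; toℕ; cast)
open import Data.Fin.Patterns
open import Data.Fin.Properties using (toℕ<n; toℕ-cast)
open import Data.Fin.Permutation
  using (_⟨$⟩ʳ_; _⟨$⟩ˡ_; inverseˡ; inverseʳ; flip; cast-id; _∘ₚ_)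
open import Data.Fin.Subset using (Subset; _∈_; Nonempty)
open import Data.List.Base as List
  using (List; []; _∷_; length; foldr; map; _++_; allFin; tabulate)
open import Data.List.Properties
  using (length-map; length-++; length-replicate; length-tabulate;
         map-++; map-∘; map-tabulate; tabulate-cong)
open import Data.List.Relation.Unary.All as All using (All; []; _∷_)
open import Data.List.Relation.Unary.All.Properties using (++⁺)
open import Data.List.Relation.Unary.Sorted.TotalOrder.Properties using (lookup-mono-≤)
open import Data.List.Relation.Binary.Permutation.Propositional using (_↭_; ↭⇒↭ₛ)
open import Data.List.Relation.Binary.Permutation.Propositional.Properties using (↭-length)
open import Data.List.Relation.Binary.Permutation.Homogeneous using (onIndices)
import Data.List.Relation.Binary.Permutation.Setoid.Properties as PermSetoid
import Data.List.Sort.InsertionSort.Base as Insertion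
import Data.List.Sort.InsertionSort.Properties as InsertionProperties
open import Data.Maybe.Base as Maybe using (Maybe; just; nothing; maybe′)
open import Data.Product.Base using (_×_; _,_; proj₁; proj₂; ∃-syntax)
open import Data.Sum.Base using (_⊎_; inj₁; inj₂)
open import Data.Vec.Base as Vec
  using (Vec; []; _∷_; lookup; updateAt; replicate; here; there)
open import Data.Vec.Properties using (lookup∘updateAt; lookup-replicate)
open import Function.Base using (_∘_; id)
open import Algebra.Properties.CommutativeMonoid.Sum +-0-commutativeMonoid
  using (sum-cong-≗; ∑-distrib-+; ∑-comm; sum-permute; sum-replicate-zero)
  renaming (sum to ∑)
open import Algebra.Properties.Semiring.Sum +-*-semiring using (*-distribˡ-sum)
open import Algebra.Properties.CommutativeSemigroup +-commutativeSemigroup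
  using () renaming (interchange to +-interchange)
open import Algebra.Properties.CommutativeSemigroup *-commutativeSemigroup
  using () renaming (interchange to *-interchange)
open import Relation.Binary.Bundles using (DecTotalOrder)
import Relation.Binary.Construct.On as On
import Relation.Binary.Construct.Flip.EqAndOrd as Flip
open import Relation.Nullary using (contradiction)
open import Relation.Binary.PropositionalEquality
  using (_≡_; refl; sym; trans; cong; cong₂; subst; subst₂; setoid; module ≡-Reasoning)

private variable
  m : ℕ

-- Pairwise bounds on the latency

∑-mono : {f g : Fin m → ℕ} → (∀ i → f i ≤ g i) → ∑ f ≤ ∑ g
∑-mono {zero}  f≤g = z≤n
∑-mono {suc m} f≤g = +-mono-≤ (f≤g zero) (∑-mono (f≤g ∘ suc))

∑-one : ∀ m → ∑ {m} (λ _ → 1) ≡ m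
∑-one zero    = refl
∑-one (suc m) = cong suc (∑-one m)

⟦_⟧ : Bool → ℕ
⟦ b ⟧ = if b then 1 else 0

⟦<⟧-yes : ∀ {a b} → a < b → ⟦ a <ᵇ b ⟧ ≡ 1
⟦<⟧-yes {a} {b} a<b with a <ᵇ b in eq
... | true  = refl
... | false = contradiction (<⇒<ᵇ a<b) (subst T eq)

⟦<⟧-≤ : ∀ {a b c d} → (a < b → c < d) → ⟦ a <ᵇ b ⟧ ≤ ⟦ c <ᵇ d ⟧
⟦<⟧-≤ {a} {b} {c} {d} h with a <ᵇ b in eq
... | false = z≤n
... | true  = ≤-reflexive (sym (⟦<⟧-yes (h (<ᵇ⇒< a b (subst T (sym eq) _)))))

∑-below : ∀ {k} m → k ≤ m → ∑ {m} (λ i → ⟦ toℕ i <ᵇ k ⟧) ≡ k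
∑-below m       z≤n       = sum-replicate-zero m
∑-below (suc m) (s≤s k≤n) = cong suc (∑-below m k≤n)

-- Positions are counted from 0, so `v` is scheduled at time `suc (rank π v)`.
rank : Ordering m → Fin m → ℕ
rank π v = toℕ (π ⟨$⟩ˡ v)

-- Reindexing along `π` leaves a count of the numbers below `k`. This is what turns a position into
-- a count of vertices.
∑-rank-below : ∀ (π : Ordering m) {k} → k ≤ m → ∑ (λ v → ⟦ rank π v <ᵇ k ⟧) ≡ k
∑-rank-below {m} π {k} k≤n =
  trans (sym (sum-permute (λ i → ⟦ toℕ i <ᵇ k ⟧) (flip π))) (∑-below m k≤n)

rank<Cov : ∀ (π : Ordering m) {e i} → i ∈ e → rank π i < Cov π e
rank<Cov π {e} {i} i∈e with proj₁ (proj₂ (earliest π e)) i i∈e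
... | j , refl , j<t = subst (λ k → toℕ k < Cov π e) (sym (inverseˡ π)) j<t

Cov≤ : ∀ (π : Ordering m) {e t} → (∀ {v} → v ∈ e → rank π v < t) → Cov π e ≤ t
Cov≤ π {e} h = proj₂ (proj₂ (earliest π e)) _ λ v v∈e → π ⟨$⟩ˡ v , inverseʳ π , h v∈e

pairMins : (Fin m → ℕ) → ℕ
pairMins L = ∑ λ v → ∑ λ w → L v ⊓ L w

-- Twice the weighted sum of positions is a sum over ordered pairs (v , w) in
-- which the later of the two vertices contributes its load.
pairs≤positions : ∀ (L : Fin m → ℕ) (π : Ordering m) →
  ∑ L + pairMins L ≤ 2 * ∑ (λ v → L v * suc (rank π v))
pairs≤positions {m} L π = begin
  ∑ L + pairMins L
    ≤⟨ +-monoʳ-≤ (∑ L) (∑-mono λ v → ∑-mono λ w → pair v w) ⟩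
  ∑ L + ∑ (λ v → ∑ λ w → before v w + after w v)
    ≡⟨ cong (∑ L +_) (trans (sum-cong-≗ λ v → ∑-distrib-+ (before v) (λ w → after w v))
                           (∑-distrib-+ (λ v → ∑ (before v)) (λ v → ∑ λ w → after w v))) ⟩
  ∑ L + (∑ (λ v → ∑ (before v)) + ∑ (λ v → ∑ λ w → after w v))
    ≡⟨ cong (λ s → ∑ L + (∑ (λ v → ∑ (before v)) + s)) (∑-comm λ v w → after w v) ⟩
  ∑ L + (∑ (λ v → ∑ (before v)) + ∑ (λ v → ∑ (after v)))
    ≡⟨ +-assoc (∑ L) _ _ ⟨
  ∑ L + ∑ (λ v → ∑ (before v)) + ∑ (λ v → ∑ (after v))
    ≡⟨ cong₂ _+_ (trans (sym (∑-distrib-+ L _)) (sum-cong-≗ strictly)) (sum-cong-≗ weakly) ⟩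
  X + X
    ≡⟨ cong (X +_) (+-identityʳ X) ⟨
  2 * X ∎
  where
  open ≤-Reasoning
  r = rank π
  X = ∑ (λ v → L v * suc (r v))
  -- The diagonal pairs are counted in `after` only. Hence `before v` falls short of
  -- `L v * suc (r v)` by `L v`, and the extra term `∑ L` makes up for it.
  before after : Fin m → Fin m → ℕ
  before v w = L v * ⟦ r w <ᵇ r v ⟧
  after  v w = L v * ⟦ r w <ᵇ suc (r v) ⟧

  strictly : ∀ v → L v + ∑ (before v) ≡ L v * suc (r v)
  strictly v = trans
    (cong (L v +_) (trans (sym (*-distribˡ-sum (L v) (λ w → ⟦ r w <ᵇ r v ⟧)))
                          (cong (L v *_) (∑-rank-below π (<⇒≤ (toℕ<n _))))))
    (sym (*-suc (L v) (r v)))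

  weakly : ∀ v → ∑ (after v) ≡ L v * suc (r v)
  weakly v = trans (sym (*-distribˡ-sum (L v) (λ w → ⟦ r w <ᵇ suc (r v) ⟧)))
                 (cong (L v *_) (∑-rank-below π (toℕ<n _)))

  times-one : ∀ {x y} → y ≡ 1 → x ≤ x * y
  times-one {x} refl = ≤-reflexive (sym (*-identityʳ x))

  pair : ∀ v w → L v ⊓ L w ≤ before v w + after w v
  pair v w with <-≤-connex (r w) (r v)
  ... | inj₁ w<v = ≤-trans (m⊓n≤m (L v) (L w))
                    (≤-trans (times-one (⟦<⟧-yes w<v)) (m≤m+n _ _))
  ... | inj₂ v≤w = ≤-trans (m⊓n≤n (L v) (L w))
                    (≤-trans (times-one (⟦<⟧-yes (s≤s v≤w))) (m≤n+m _ (before v w)))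

-- The test says `L v ≤ L w + 1`, so a pair that passes it contributes at most one more than
-- `L v ⊓ L w`. These surpluses add up to at most `m * m`.
near≤pairs : ∀ (L : Fin m → ℕ) →
  ∑ (λ v → L v * ∑ (λ w → ⟦ L v <ᵇ 2 + L w ⟧)) ≤ pairMins L + m * m
near≤pairs {m} L = begin
  ∑ (λ v → L v * ∑ (λ w → ⟦ L v <ᵇ 2 + L w ⟧))
    ≡⟨ sum-cong-≗ (λ v → *-distribˡ-sum (L v) (λ w → ⟦ L v <ᵇ 2 + L w ⟧)) ⟩
  ∑ (λ v → ∑ λ w → L v * ⟦ L v <ᵇ 2 + L w ⟧)
    ≤⟨ ∑-mono (λ v → ∑-mono (pair v)) ⟩
  ∑ (λ v → ∑ λ w → L v ⊓ L w + 1)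
    ≡⟨ sum-cong-≗ (λ v → trans (∑-distrib-+ (λ w → L v ⊓ L w) _)
                              (cong (∑ (λ w → L v ⊓ L w) +_) (∑-one m))) ⟩
  ∑ (λ v → ∑ (λ w → L v ⊓ L w) + m)
    ≡⟨ ∑-distrib-+ (λ v → ∑ λ w → L v ⊓ L w) _ ⟩
  pairMins L + ∑ {m} (λ _ → m)
    ≡⟨ cong (pairMins L +_)
            (trans (sum-cong-≗ {m} (λ _ → sym (*-identityʳ m)))
                   (trans (sym (*-distribˡ-sum {m} m (λ _ → 1))) (cong (m *_) (∑-one m)))) ⟩
  pairMins L + m * m ∎
  where
  open ≤-Reasoning
  pair : ∀ v w → L v * ⟦ L v <ᵇ 2 + L w ⟧ ≤ L v ⊓ L w + 1
  pair v w with L v <ᵇ 2 + L w in eq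
  ... | false = subst (_≤ L v ⊓ L w + 1) (sym (*-zeroʳ (L v))) z≤n
  ... | true  = begin
    L v * 1           ≡⟨ *-identityʳ (L v) ⟩
    L v               ≤⟨ ⊓-glb (m≤m+n (L v) 1)
                           (≤-trans (s≤s⁻¹ (<ᵇ⇒< (L v) _ (subst T (sym eq) _)))
                                    (≤-reflexive (+-comm 1 (L w)))) ⟩
    (L v + 1) ⊓ (L w + 1) ≡⟨ +-distribʳ-⊓ 1 (L v) (L w) ⟨
    L v ⊓ L w + 1     ∎

-- Charging units of edges to vertices

-- A unit (e , i) is a fraction of the edge e that is charged to the vertex i.
Unit : ℕ → Set
Unit m = Subset m × Fin m

inc : Vec ℕ m → Fin m → Vec ℕ m
inc L i = updateAt L i suc

loads : List (Unit m) → Vec ℕ m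
loads = foldr (λ u L → inc L (proj₂ u)) (replicate _ 0)

∑-inc : ∀ (L : Vec ℕ m) i (f : Fin m → ℕ) →
  ∑ (λ v → lookup (inc L i) v * f v) ≡ f i + ∑ (λ v → lookup L v * f v)
∑-inc (l ∷ L) zero    f = +-assoc (f zero) (l * f zero) _
∑-inc (l ∷ L) (suc i) f = trans (cong (l * f zero +_) (∑-inc L i (f ∘ suc)))
  (solve 3 (λ a b c → a :+ (b :+ c) := b :+ (a :+ c)) refl (l * f zero) (f (suc i)) _)
  where open +-*-Solver

-- Double counting: grouping the units by charged vertex turns a sum over units into a load-weighted
-- sum over vertices.
∑-loads : ∀ (f : Fin m → ℕ) us →
  sum (map (f ∘ proj₂) us) ≡ ∑ (λ v → lookup (loads us) v * f v)
∑-loads {m} f [] = sym (trans (sum-cong-≗ {m} (λ v → cong (_* f v) (lookup-0 v)))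
                              (sum-replicate-zero m))
  where
  lookup-0 : ∀ {m} (v : Fin m) → lookup (replicate m 0) v ≡ 0
  lookup-0 zero    = refl
  lookup-0 (suc v) = lookup-0 v
∑-loads f (u ∷ us) = trans (cong (f (proj₂ u) +_) (∑-loads f us))
                           (sym (∑-inc (loads us) (proj₂ u) f))

∑-loads-total : (us : List (Unit m)) → ∑ (lookup (loads us)) ≡ length us
∑-loads-total us = trans (sum-cong-≗ (λ v → sym (*-identityʳ (lookup (loads us) v))))
                         (trans (sym (∑-loads (λ _ → 1) us)) (count us))
  where
  count : ∀ {A : Set} (xs : List A) → sum (map (λ _ → 1) xs) ≡ length xs
  count []       = refl
  count (x ∷ xs) = cong suc (count xs)

sum-mono : ∀ {A : Set} {f g : A → ℕ} {xs} → All (λ x → f x ≤ g x) xs →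
           sum (map f xs) ≤ sum (map g xs)
sum-mono []            = z≤n
sum-mono (fx≤gx ∷ all) = +-mono-≤ fx≤gx (sum-mono all)

Valid : Unit m → Set
Valid (e , i) = i ∈ e

-- Local optimality: no vertex of the edge has a load smaller by 2 or more than that of the charged
-- vertex.
Settled : Vec ℕ m → Unit m → Set
Settled L (e , i) = ∀ {j} → j ∈ e → lookup L i ≤ suc (lookup L j)

SortedBy : (Fin m → ℕ) → Ordering m → Set
SortedBy L σ = ∀ {v w} → rank σ v ≤ rank σ w → L w ≤ L v

module _ (us : List (Unit m)) (valid : All Valid us) where

  private
    L : Fin m → ℕ
    L = lookup (loads us)

  -- An edge is covered no earlier than any of its vertices is scheduled, in particular the one
  -- charged by the unit.
  coverLowerBound : ∀ π → length us + pairMins L ≤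
                          2 * sum (map (Cov π ∘ proj₁) us)
  coverLowerBound π = begin
    length us + pairMins L ≡⟨ cong (_+ pairMins L) (∑-loads-total us) ⟨
    ∑ L + pairMins L       ≤⟨ pairs≤positions L π ⟩
    2 * ∑ (λ v → L v * suc (rank π v))      ≡⟨ cong (2 *_) (∑-loads (suc ∘ rank π) us) ⟨
    2 * sum (map (suc ∘ rank π ∘ proj₂) us)
      ≤⟨ *-monoʳ-≤ 2 (sum-mono (All.map (λ {u} → rank<Cov π {proj₁ u}) valid)) ⟩
    2 * sum (map (Cov π ∘ proj₁) us)        ∎
    where open ≤-Reasoning

  coverUpperBound : ∀ σ → SortedBy L σ → All (Settled (loads us)) us →
    sum (map (Cov σ ∘ proj₁) us) ≤ pairMins L + m * m
  coverUpperBound σ sorted settled = begin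
    sum (map (Cov σ ∘ proj₁) us)        ≤⟨ sum-mono (All.map cover settled) ⟩
    sum (map (near ∘ proj₂) us)         ≡⟨ ∑-loads near us ⟩
    ∑ (λ v → L v * near v)              ≤⟨ near≤pairs L ⟩
    pairMins L + m * m ∎
    where
    open ≤-Reasoning
    near : Fin m → ℕ
    near v = ∑ (λ w → ⟦ L v <ᵇ 2 + L w ⟧)

    -- For `z` in the edge, every `w` scheduled no later than `z` has `L z ≤ L w`, while settledness
    -- gives `L i ≤ L z + 1`. So `near i` counts all these `w`, and their number is the time of `z`.
    cover : ∀ {u} → Settled (loads us) u → Cov σ (proj₁ u) ≤ near (proj₂ u)
    cover {e , i} settledᵤ = Cov≤ σ λ {z} z∈e → begin
      suc (rank σ z)                            ≡⟨ ∑-rank-below σ (toℕ<n _) ⟨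
      ∑ (λ w → ⟦ rank σ w <ᵇ suc (rank σ z) ⟧)
        ≤⟨ ∑-mono (λ w → ⟦<⟧-≤ {rank σ w} {_} {L i} λ w≤z →
             s≤s (≤-trans (settledᵤ z∈e) (s≤s (sorted (s≤s⁻¹ w≤z))))) ⟩
      near i                                    ∎

  -- The error `m * m` of the upper bound is absorbed by the term `length us` of the lower bound;
  -- hence the demand for many units.
  coverRatio : ∀ σ → SortedBy L σ → All (Settled (loads us)) us → m * m ≤ length us →
    ∀ π → sum (map (Cov σ ∘ proj₁) us) ≤ 2 * sum (map (Cov π ∘ proj₁) us)
  coverRatio σ sorted settled enough π = begin
    _                                         ≤⟨ coverUpperBound σ sorted settled ⟩
    _                                         ≤⟨ +-monoʳ-≤ (pairMins L) enough ⟩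
    pairMins L + length us   ≡⟨ +-comm _ (length us) ⟩
    length us + pairMins L   ≤⟨ coverLowerBound π ⟩
    _                                         ∎
    where open ≤-Reasoning

-- Local search

-- The `suc l` demands a gap of at least 2. A move across a gap of 1 would only exchange the two
-- loads and leave the sum of squares as it was.
find : Subset m → Vec ℕ m → ℕ → Maybe (Fin m)
find []          []      x = nothing
find (false ∷ e) (l ∷ L) x = Maybe.map suc (find e L x)
find (true ∷ e)  (l ∷ L) x =
  if suc l <ᵇ x then just zero else Maybe.map suc (find e L x)

find-just : ∀ (e : Subset m) L {x j} → find e L x ≡ just j → j ∈ e × suc (lookup L j) < x
find-just (false ∷ e) (l ∷ L) {x} eq with find e L x in eq′
find-just (false ∷ e) (l ∷ L) refl | just j with find-just e L eq′
... | j∈e , lt = there j∈e , lt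
find-just (true ∷ e) (l ∷ L) {x} eq with suc l <ᵇ x in eqb
find-just (true ∷ e) (l ∷ L) {x} refl | true = here , <ᵇ⇒< (suc l) x (subst T (sym eqb) _)
find-just (true ∷ e) (l ∷ L) {x} eq   | false with find e L x in eq′
find-just (true ∷ e) (l ∷ L) refl | false | just j with find-just e L eq′
... | j∈e , lt = there j∈e , lt

find-nothing : ∀ (e : Subset m) L {x j} → find e L x ≡ nothing → j ∈ e → x ≤ suc (lookup L j)
find-nothing (false ∷ e) (l ∷ L) {x} eq (there j∈e) with find e L x in eq′
... | nothing = find-nothing e L eq′ j∈e
find-nothing (true ∷ e) (l ∷ L) {x} eq j∈e with suc l <ᵇ x in eqb
find-nothing (true ∷ e) (l ∷ L) {x} eq here | false =
  ≮⇒≥ λ lt → subst T eqb (<⇒<ᵇ lt)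
find-nothing (true ∷ e) (l ∷ L) {x} eq (there j∈e) | false with find e L x in eq′
... | nothing = find-nothing e L eq′ j∈e

-- Only the first movable unit moves, so `L` can stay the load vector of the whole list throughout
-- the recursion.
step : Vec ℕ m → List (Unit m) → List (Unit m)
step L []             = []
step L ((e , i) ∷ us) =
  maybe′ (λ j → (e , j) ∷ us) ((e , i) ∷ step L us) (find e L (lookup L i))

improve : ℕ → List (Unit m) → List (Unit m)
improve zero    us = us
improve (suc k) us = improve k (step (loads us) us)

-- When all loads are 0, the threshold 2 makes find return the first vertex of e.
initial : List (Subset m) → List (Unit m)
initial []       = []
initial (e ∷ es) =
  maybe′ (λ j → (e , j) ∷ initial es) (initial es) (find e (replicate _ 0) 2)

step-edges : ∀ L (us : List (Unit m)) → map proj₁ (step L us) ≡ map proj₁ us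
step-edges L []             = refl
step-edges L ((e , i) ∷ us) with find e L (lookup L i)
... | just j  = refl
... | nothing = cong (e ∷_) (step-edges L us)

step-valid : ∀ L {us : List (Unit m)} → All Valid us → All Valid (step L us)
step-valid L []             = []
step-valid L {(e , i) ∷ us} (i∈e ∷ valid) with find e L (lookup L i) in eq
... | just j  = proj₁ (find-just e L eq) ∷ valid
... | nothing = i∈e ∷ step-valid L valid

improve-edges : ∀ k (us : List (Unit m)) → map proj₁ (improve k us) ≡ map proj₁ us
improve-edges zero    us = refl
improve-edges (suc k) us = trans (improve-edges k _) (step-edges (loads us) us)

improve-valid : ∀ k {us : List (Unit m)} → All Valid us → All Valid (improve k us)
improve-valid zero         valid = valid
improve-valid (suc k) {us} valid = improve-valid k (step-valid (loads us) valid)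

initial-correct : {es : List (Subset m)} → All Nonempty es →
                  map proj₁ (initial es) ≡ es × All Valid (initial es)
initial-correct [] = refl , []
initial-correct {m} {e ∷ es} ((i , i∈e) ∷ nonempty)
  with find e (replicate m 0) 2 in eq | initial-correct nonempty
... | just j  | edges≡ , valid = cong (e ∷_) edges≡ , proj₁ (find-just e _ eq) ∷ valid
... | nothing | _ = contradiction
  (subst (λ l → 2 ≤ suc l) (lookup-replicate i 0) (find-nothing e _ eq i∈e)) λ { (s≤s ()) }

-- The sum of squared loads as a potential

inc-comm : ∀ (L : Vec ℕ m) i j → inc (inc L i) j ≡ inc (inc L j) i
inc-comm (l ∷ L) zero    zero    = refl
inc-comm (l ∷ L) zero    (suc j) = refl
inc-comm (l ∷ L) (suc i) zero    = refl
inc-comm (l ∷ L) (suc i) (suc j) = cong (l ∷_) (inc-comm L i j)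

lookup≤inc : ∀ (L : Vec ℕ m) i j → lookup L j ≤ lookup (inc L i) j
lookup≤inc (l ∷ L) zero    zero    = n≤1+n l
lookup≤inc (l ∷ L) zero    (suc j) = ≤-refl
lookup≤inc (l ∷ L) (suc i) zero    = ≤-refl
lookup≤inc (l ∷ L) (suc i) (suc j) = lookup≤inc L i j

-- Increments commute, so the contribution of a unit can be split off wherever it stands in the
-- list.
loads-middle : ∀ (us : List (Unit m)) u vs →
               loads (us ++ u ∷ vs) ≡ inc (loads (us ++ vs)) (proj₂ u)
loads-middle []       u vs = refl
loads-middle (x ∷ us) u vs = trans (cong (λ L → inc L (proj₂ x)) (loads-middle us u vs))
                                   (inc-comm (loads (us ++ vs)) (proj₂ u) (proj₂ x))

potential : Vec ℕ m → ℕ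
potential L = ∑ (λ v → lookup L v * lookup L v)

potential-inc : ∀ (L : Vec ℕ m) i → potential (inc L i) ≡ suc (2 * lookup L i) + potential L
potential-inc (l ∷ L) zero =
  solve 2 (λ l p → (con 1 :+ l) :* (con 1 :+ l) :+ p :=
                   con 1 :+ con 2 :* l :+ (l :* l :+ p)) refl l (potential L)
  where open +-*-Solver
potential-inc (l ∷ L) (suc i) = trans (cong (l * l +_) (potential-inc L i))
  (solve 3 (λ a x p → a :+ (con 1 :+ con 2 :* x :+ p) :=
                      con 1 :+ con 2 :* x :+ (a :+ p)) refl (l * l) (lookup L i) (potential L))
  where open +-*-Solver

-- Both load vectors arise by one increment from `R`, the loads of the other units. By
-- `potential-inc` it remains to compare the loads of the two vertices in `R`.
potential-move : ∀ (us vs : List (Unit m)) {u v} →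
  let L = loads (us ++ u ∷ vs) in suc (lookup L (proj₂ v)) < lookup L (proj₂ u) →
  potential (loads (us ++ v ∷ vs)) < potential L
potential-move us vs {u} {v} lt =
  subst₂ (λ L′ L → potential L′ < potential L)
    (sym (loads-middle us v vs)) (sym (loads-middle us u vs))
    (subst₂ _<_ (sym (potential-inc R j)) (sym (potential-inc R i))
      (s≤s (+-monoˡ-< (potential R) (*-monoʳ-< 2 lighter))))
  where
  open ≤-Reasoning
  R = loads (us ++ vs)
  i = proj₂ u
  j = proj₂ v
  -- Removing the unit lowers the load of `i` by 1, so a gap of at least 2 leaves a gap of at least
  -- 1.
  lighter : lookup R j < lookup R i
  lighter = begin-strict
    lookup R j         ≤⟨ lookup≤inc R i j ⟩
    lookup (inc R i) j <⟨ s≤s⁻¹ (subst (suc (lookup (inc R i) j) <_) (lookup∘updateAt i R)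
                            (subst (λ L → suc (lookup L j) < lookup L i) (loads-middle us u vs) lt)) ⟩
    lookup R i         ∎

-- The second alternative exhibits the moved unit in its context, in the shape that `potential-move`
-- expects.
StepResult : Vec ℕ m → List (Unit m) → Set
StepResult L us = (All (Settled L) us × step L us ≡ us) ⊎
  ∃[ as ] ∃[ u ] ∃[ v ] ∃[ bs ] us ≡ as ++ u ∷ bs × step L us ≡ as ++ v ∷ bs ×
    suc (lookup L (proj₂ v)) < lookup L (proj₂ u)

step-result : ∀ L (us : List (Unit m)) → StepResult L us
step-result L []             = inj₁ ([] , refl)
step-result L ((e , i) ∷ us) with find e L (lookup L i) in eq
... | just j  = inj₂ ([] , (e , i) , (e , j) , us , refl , refl , proj₂ (find-just e L eq))
... | nothing with step-result L us
...   | inj₁ (settled , fixed) = inj₁ ((find-nothing e L eq ∷ settled) , cong ((e , i) ∷_) fixed)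
...   | inj₂ (as , u , v , bs , us≡ , step≡ , lt) =
  inj₂ ((e , i) ∷ as , u , v , bs , cong (_ ∷_) us≡ , cong (_ ∷_) step≡ , lt)

step-progress : ∀ (us : List (Unit m)) → let us′ = step (loads us) us in
  (All (Settled (loads us)) us × us′ ≡ us) ⊎ potential (loads us′) < potential (loads us)
step-progress us with step-result (loads us) us
... | inj₁ fixed = inj₁ fixed
... | inj₂ (as , u , v , bs , refl , step≡ , lt) =
  inj₂ (subst (λ us′ → potential (loads us′) < potential (loads (as ++ u ∷ bs)))
              (sym step≡) (potential-move as bs lt))

improve-fixed : ∀ k (us : List (Unit m)) → step (loads us) us ≡ us → improve k us ≡ us
improve-fixed zero    us fixed = refl
improve-fixed (suc k) us fixed = trans (cong (improve k) fixed) (improve-fixed k us fixed)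

-- A round either moves a unit and lowers the potential, or finds all units settled, after which the
-- remaining rounds change nothing. So the initial potential bounds the number of moves.
improve-settled : ∀ k (us : List (Unit m)) → potential (loads us) ≤ k →
                  All (Settled (loads (improve k us))) (improve k us)
improve-settled k us bound with step-progress us
improve-settled k us bound | inj₁ (settled , fixed)
  rewrite improve-fixed k us fixed = settled
improve-settled zero    us bound | inj₂ lt = contradiction (≤-trans lt bound) λ ()
improve-settled (suc k) us bound | inj₂ lt =
  improve-settled k _ (s≤s⁻¹ (≤-trans lt bound))

∑-bound : ∀ (f : Fin m → ℕ) i → f i ≤ ∑ f
∑-bound f zero    = m≤m+n (f zero) _
∑-bound f (suc i) = ≤-trans (∑-bound (f ∘ suc) i) (m≤n+m _ (f zero))

load≤length : ∀ (us : List (Unit m)) v → lookup (loads us) v ≤ length us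
load≤length us v = ≤-trans (∑-bound (lookup (loads us)) v) (≤-reflexive (∑-loads-total us))

-- With the loads themselves as weights, `∑-loads` writes the sum of squares as a sum over units of
-- the load of the charged vertex, and no load exceeds the number of units.
potential≤ : ∀ (us : List (Unit m)) → potential (loads us) ≤ length us * length us
potential≤ us = begin
  potential (loads us)                           ≡⟨ ∑-loads (lookup (loads us)) us ⟨
  sum (map (λ u → lookup (loads us) (proj₂ u)) us) ≤⟨ bound us ⟩
  length us * length us                          ∎
  where
  open ≤-Reasoning
  bound : ∀ vs → sum (map (λ u → lookup (loads us) (proj₂ u)) vs) ≤ length vs * length us
  bound []       = z≤n
  bound (v ∷ vs) = +-mono-≤ (load≤length us (proj₂ v)) (bound vs)

-- Ordering the vertices by decreasing load

byLoad : Vec ℕ m → DecTotalOrder _ _ _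
byLoad L = On.decTotalOrder (Flip.decTotalOrder ≤-decTotalOrder) (lookup L)

byLoadDescending : Vec ℕ m → List (Fin m)
byLoadDescending {m} L = Insertion.sort (byLoad L) (allFin m)

module _ {xs : List (Fin m)} (xs↭ : xs ↭ allFin m) where

  private
    length≡ : m ≡ length xs
    length≡ = sym (trans (↭-length xs↭) (length-tabulate id))

  -- The permutation proof matches the positions in `xs` with those in `allFin m`, which are the
  -- vertices; the casts only adjust index types.
  fromEnumeration : Ordering m
  fromEnumeration =
    cast-id length≡ ∘ₚ onIndices (↭⇒↭ₛ xs↭) ∘ₚ cast-id (length-tabulate id)

  fromEnumeration-lookup : ∀ i → fromEnumeration ⟨$⟩ʳ i ≡ List.lookup xs (cast length≡ i)
  fromEnumeration-lookup i = sym (trans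
    (PermSetoid.onIndices-lookup (setoid (Fin m)) (↭⇒↭ₛ xs↭) (cast length≡ i))
    (lookup-tabulate id _ _))
    where
    lookup-tabulate : ∀ {k} (f : Fin k → Fin m) i .(eq : length (tabulate f) ≡ k) →
                    List.lookup (tabulate f) i ≡ f (cast eq i)
    lookup-tabulate {suc k} f zero    eq = refl
    lookup-tabulate {suc k} f (suc i) eq = lookup-tabulate (f ∘ suc) i _

  fromEnumeration-tabulate : tabulate (fromEnumeration ⟨$⟩ʳ_) ≡ xs
  fromEnumeration-tabulate = trans (tabulate-cong fromEnumeration-lookup) (tabulate-cast xs length≡)
    where
    tabulate-cast : ∀ {k} (ys : List (Fin m)) .(eq : k ≡ length ys) →
                    tabulate (List.lookup ys ∘ cast eq) ≡ ys
    tabulate-cast {zero}  []       eq = refl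
    tabulate-cast {suc k} (y ∷ ys) eq = cong (y ∷_) (tabulate-cast ys _)

byLoadDescending-↭ : (L : Vec ℕ m) → byLoadDescending L ↭ allFin m
byLoadDescending-↭ L = InsertionProperties.sort-↭ (byLoad L) (allFin _)

loadOrdering : Vec ℕ m → Ordering m
loadOrdering L = fromEnumeration (byLoadDescending-↭ L)

loadOrdering-tabulate : (L : Vec ℕ m) → tabulate (loadOrdering L ⟨$⟩ʳ_) ≡ byLoadDescending L
loadOrdering-tabulate L = fromEnumeration-tabulate (byLoadDescending-↭ L)

loadOrdering-sorted : (L : Vec ℕ m) → SortedBy (lookup L) (loadOrdering L)
loadOrdering-sorted {m} L {v} {w} v≤w = subst₂ (λ x y → lookup L y ≤ lookup L x) (at v) (at w)
  (lookup-mono-≤ (DecTotalOrder.totalOrder (byLoad L))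
    (InsertionProperties.sort-↗ (byLoad L) (allFin m))
    (subst₂ _≤_ (sym (toℕ-cast _ (σ ⟨$⟩ˡ v))) (sym (toℕ-cast _ (σ ⟨$⟩ˡ w))) v≤w))
  where
  σ = loadOrdering L
  at : ∀ u → List.lookup (byLoadDescending L) (cast _ (σ ⟨$⟩ˡ u)) ≡ u
  at u = trans (sym (fromEnumeration-lookup (byLoadDescending-↭ L) (σ ⟨$⟩ˡ u)))
               (inverseʳ σ)

-- The first list acts as a unary counter, the form in which the tree program has its numbers.
copies : ∀ {A B : Set} → List A → List B → List B
copies []       ys = []
copies (_ ∷ xs) ys = ys ++ copies xs ys

length-copies : ∀ {A B : Set} (xs : List A) (ys : List B) →
                length (copies xs ys) ≡ length xs * length ys
length-copies []       ys = refl
length-copies (x ∷ xs) ys = trans (length-++ ys) (cong (length ys +_) (length-copies xs ys))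

sum-copies : ∀ {A B : Set} (f : B → ℕ) (xs : List A) ys →
             sum (map f (copies xs ys)) ≡ length xs * sum (map f ys)
sum-copies f []       ys = refl
sum-copies f (x ∷ xs) ys = trans (cong sum (map-++ f ys _))
  (trans (sum-++ (map f ys) _) (cong (sum (map f ys) +_) (sum-copies f xs ys)))

all-copies : ∀ {A B : Set} {P : B → Set} (xs : List A) {ys} → All P ys → All P (copies xs ys)
all-copies []       pys = []
all-copies (x ∷ xs) pys = ++⁺ pys (all-copies xs pys)

-- The program and its running time

arities : Vec ℕ 12
arities = 2 ∷ 2 ∷ 2 ∷ 3 ∷ 2 ∷ 2 ∷ 3 ∷ 2 ∷ 2 ∷ 2 ∷ 3 ∷ 3 ∷ []

pattern ltᶠ      = 0F
pattern lookupᶠ  = 1F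
pattern incᶠ     = 2F
pattern findᶠ    = 3F
pattern loadsᶠ   = 4F
pattern stepᶠ    = 5F
pattern improveᶠ = 6F
pattern appendᶠ  = 7F
pattern copiesᶠ  = 8F
pattern initialᶠ = 9F
pattern insertᶠ  = suc 9F
pattern sortᶠ    = suc (suc 9F)

pattern v0 = var 0F
pattern v1 = var 1F
pattern v2 = var 2F
pattern v3 = var 3F
pattern v4 = var 4F
pattern v5 = var 5F
pattern v6 = var 6F
pattern v8 = var 8F

-- In the second branch of a `match`, `v0` is the head, `v1` the tail, and all older indices grow by
-- 2.
bodies : (f : Fin 12) → Expr (lookup arities) (lookup arities f)
bodies ltᶠ = match v1 nil (match v2 (cons nil nil) (call ltᶠ (v1 ∷ v3 ∷ [])))
bodies lookupᶠ = match v0 nil (match v3 v0 (call lookupᶠ (v3 ∷ v1 ∷ [])))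
bodies incᶠ = match v0 nil (match v3
  (cons (cons nil v0) v1)
  (cons v2 (call incᶠ (v3 ∷ v1 ∷ []))))
bodies findᶠ = match v0 nil (match v3 nil
  -- The inner `match` computes one condition, non-`nil` exactly if the vertex is in the edge and
  -- light enough.
  (match (match v2 nil (call ltᶠ (cons nil v2 ∷ v8 ∷ [])))
    (match (call findᶠ (v3 ∷ v1 ∷ v6 ∷ [])) nil (cons nil (cons nil v1)))
    (cons nil nil)))
bodies loadsᶠ = match v0 v1 (match v0 nil
  (call incᶠ (call loadsᶠ (v3 ∷ v5 ∷ []) ∷ v1 ∷ [])))
bodies stepᶠ = match v0 nil (match v0 nil
  (match (call findᶠ (v0 ∷ v5 ∷ call lookupᶠ (v5 ∷ v1 ∷ []) ∷ []))
    (cons v2 (call stepᶠ (v3 ∷ v5 ∷ [])))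
    (cons (cons v2 v1) v5)))
bodies improveᶠ = match v0 v1
  (call improveᶠ (v1 ∷ call stepᶠ (v3 ∷ call loadsᶠ (v3 ∷ v4 ∷ []) ∷ []) ∷ v4 ∷ []))
bodies appendᶠ = match v0 v1 (cons v0 (call appendᶠ (v1 ∷ v3 ∷ [])))
bodies copiesᶠ = match v0 nil (call appendᶠ (v3 ∷ call copiesᶠ (v1 ∷ v3 ∷ []) ∷ []))
bodies initialᶠ = match v0 nil
  (match (call findᶠ (v0 ∷ v3 ∷ cons nil (cons nil nil) ∷ []))
    (call initialᶠ (v1 ∷ v3 ∷ []))
    (cons (cons v2 v1) (call initialᶠ (v3 ∷ v5 ∷ []))))
bodies insertᶠ = match v2 (cons v1 nil)
  (match (call ltᶠ (call lookupᶠ (v2 ∷ v0 ∷ []) ∷ cons nil (call lookupᶠ (v2 ∷ v3 ∷ [])) ∷ []))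
    (cons v0 (call insertᶠ (v2 ∷ v3 ∷ v1 ∷ [])))
    (cons v5 v6))
-- The arguments are the loads, the number of vertices left and the next vertex, so `allFin` is
-- generated on the fly.
bodies sortᶠ = match v1 nil
  (call insertᶠ (v2 ∷ v4 ∷ call sortᶠ (v2 ∷ v1 ∷ cons nil v4 ∷ []) ∷ []))

program : Program
program = record
  { m     = 12
  ; arity = lookup arities
  ; body  = bodies
  ; main  = match v0 nil
      -- Here `v0` is the vertex count in unary and `v1` the list of edges.
      (let′ (call initialᶠ (call copiesᶠ (call copiesᶠ (v0 ∷ v0 ∷ []) ∷ v1 ∷ []) ∷ v0 ∷ []))
        (let′ (call loadsᶠ (call improveᶠ (call copiesᶠ (v0 ∷ v0 ∷ []) ∷ v0 ∷ v1 ∷ []) ∷ v1 ∷ []))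
          (call sortᶠ (v0 ∷ v2 ∷ nil ∷ []))))
  }

open Semantics program

-- Evaluation with explicit cost bounds

private variable
  Γ k l : ℕ
  ρ : Vec Tree Γ
  u v x y : Tree
  vs : Vec Tree k
  a b c : Expr (lookup arities) Γ
  as : Vec (Expr (lookup arities) Γ) k
  xs ys : List ℕ

-- The bound on the running time is kept as a numeral plus a list of the bounds
-- of the functions called, in order of evaluation, so that for concrete
-- expressions it normalises.
record Eval {Γ} (ρ : Vec Tree Γ) (a : Expr (lookup arities) Γ) (v : Tree)
            (k : ℕ) (xs : List ℕ) : Set where
  constructor eval
  field derive : ∀ ω → ∃[ t ] t ≤ k + sum xs × (ρ , ω ⊢ a ⇓[ t ] v , ω)

record Eval* {Γ j} (ρ : Vec Tree Γ) (as : Vec (Expr (lookup arities) Γ) j) (vs : Vec Tree j)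
             (k : ℕ) (xs : List ℕ) : Set where
  constructor eval
  field derive : ∀ ω → ∃[ t ] t ≤ k + sum xs × (ρ , ω ⊢ as ⇓*[ t ] vs , ω)

record Run (f : Fin 12) (vs : Vec Tree (lookup arities f)) (v : Tree) (B : ℕ) : Set where
  constructor eval
  field derive : ∀ ω → ∃[ t ] t ≤ B × (vs , ω ⊢ bodies f ⇓[ t ] v , ω)

combine-bounds : ∀ k l xs ys {s t} → s ≤ k + sum xs → t ≤ l + sum ys →
                 s + t ≤ (k + l) + sum (xs ++ ys)
combine-bounds k l xs ys {s} {t} s≤ t≤ = begin
  s + t                       ≤⟨ +-mono-≤ s≤ t≤ ⟩
  (k + sum xs) + (l + sum ys) ≡⟨ +-interchange k (sum xs) l (sum ys) ⟩
  (k + l) + (sum xs + sum ys) ≡⟨ cong (k + l +_) (sum-++ xs ys) ⟨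
  (k + l) + sum (xs ++ ys)    ∎
  where open ≤-Reasoning

eval-var : ∀ i → Eval ρ (var i) (lookup ρ i) 1 []
eval-var i = eval λ ω → 1 , ≤-refl , ⇓var

eval-nil : Eval ρ nil nil 1 []
eval-nil = eval λ ω → 1 , ≤-refl , ⇓nil

eval-cons : Eval ρ a u k xs → Eval ρ b v l ys →
            Eval ρ (cons a b) (u ∙ v) (suc (k + l)) (xs ++ ys)
eval-cons {k = k} {xs} {l = l} {ys} (eval p) (eval q) = eval λ ω →
  let s , s≤ , p′ = p ω ; t , t≤ , q′ = q ω
  in _ , s≤s (combine-bounds k l xs ys s≤ t≤) , ⇓cons p′ q′

eval-match-nil : Eval ρ a nil k xs → Eval ρ b v l ys →
                 Eval ρ (match a b c) v (suc (k + l)) (xs ++ ys)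
eval-match-nil {k = k} {xs} {l = l} {ys} (eval p) (eval q) = eval λ ω →
  let s , s≤ , p′ = p ω ; t , t≤ , q′ = q ω
  in _ , s≤s (combine-bounds k l xs ys s≤ t≤) , ⇓match-nil p′ q′

eval-match-cons : Eval ρ a (x ∙ y) k xs → Eval (x ∷ y ∷ ρ) c v l ys →
                  Eval ρ (match a b c) v (suc (k + l)) (xs ++ ys)
eval-match-cons {k = k} {xs} {l = l} {ys} (eval p) (eval q) = eval λ ω →
  let s , s≤ , p′ = p ω ; t , t≤ , q′ = q ω
  in _ , s≤s (combine-bounds k l xs ys s≤ t≤) , ⇓match-cons p′ q′

eval-let : Eval ρ a u k xs → Eval (u ∷ ρ) b v l ys →
           Eval ρ (let′ a b) v (suc (k + l)) (xs ++ ys)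
eval-let {k = k} {xs} {l = l} {ys} (eval p) (eval q) = eval λ ω →
  let s , s≤ , p′ = p ω ; t , t≤ , q′ = q ω
  in _ , s≤s (combine-bounds k l xs ys s≤ t≤) , ⇓let p′ q′

-- For a branch that skips some calls: the branches of one body must show the same list of bounds to
-- fit one `loop`.
eval-pad : ∀ zs → Eval ρ a v k xs → Eval ρ a v k (zs ++ xs)
eval-pad {k = k} {xs} zs (eval p) = eval λ ω → let t , t≤ , p′ = p ω in
  t , ≤-trans t≤ (+-monoʳ-≤ k (≤-trans (m≤n+m (sum xs) (sum zs))
                                       (≤-reflexive (sym (sum-++ zs xs))))) , p′

eval-[] : Eval* ρ [] [] 0 []
eval-[] = eval λ ω → 0 , ≤-refl , ⇓[]

infixr 5 _∷ᵉ_
_∷ᵉ_ : Eval ρ a v k xs → Eval* ρ as vs l ys → Eval* ρ (a ∷ as) (v ∷ vs) (k + l) (xs ++ ys)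
_∷ᵉ_ {k = k} {xs} {l = l} {ys} (eval p) (eval q) = eval λ ω →
  let s , s≤ , p′ = p ω ; t , t≤ , q′ = q ω
  in _ , combine-bounds k l xs ys s≤ t≤ , ⇓∷ p′ q′

eval-call : ∀ {f vs v B} {as : Vec (Expr (lookup arities) Γ) (lookup arities f)} →
            Eval* ρ as vs k xs → Run f vs v B → Eval ρ (call f as) v (suc k) (xs ++ B ∷ [])
eval-call {k = k} {xs} {B = B} (eval p) (eval q) = eval λ ω →
  let s , s≤ , p′ = p ω ; t , t≤ , q′ = q ω
  in _ , s≤s (subst (λ k′ → s + t ≤ k′ + sum (xs ++ B ∷ [])) (+-identityʳ k)
              (combine-bounds k 0 xs (B ∷ []) s≤ (≤-trans t≤ (≤-reflexive (sym (+-identityʳ B))))))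
       , ⇓call p′ q′

run : ∀ {f vs v B} → Eval vs (bodies f) v k xs → k + sum xs ≤ B → Run f vs v B
run (eval p) bound = eval λ ω → let t , t≤ , p′ = p ω in t , ≤-trans t≤ bound , p′

weaken : ∀ {f vs v B C} → B ≤ C → Run f vs v B → Run f vs v C
weaken B≤C (eval p) = eval λ ω → let t , t≤ , p′ = p ω in t , ≤-trans t≤ B≤C , p′

-- loop k xs r bounds a function that recurses r times, where one iteration
-- takes k steps and calls functions of cost xs.  It is abstract so that k, xs
-- and r can be inferred.
abstract
  loop : ℕ → List ℕ → ℕ → ℕ
  loop k xs r = suc r * (k + sum xs)

  loop-unfold : ∀ k xs r → loop k xs r ≡ suc r * (k + sum xs)
  loop-unfold k xs r = refl

  loop-mono : ∀ k xs {r s} → r ≤ s → loop k xs r ≤ loop k xs s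
  loop-mono k xs r≤s = *-monoˡ-≤ (k + sum xs) (s≤s r≤s)

  loop-once : ∀ k xs r → k + sum xs ≤ loop k xs r
  loop-once k xs r = m≤m+n (k + sum xs) _

  loop-suc : ∀ k xs r → k + sum xs + loop k xs r ≡ loop k xs (suc r)
  loop-suc k xs r = refl

-- For branches without a recursive call; `ys` are the bounds of calls that the branch does not
-- reach.
run-exit : ∀ {f vs v j k ys r} → Eval vs (bodies f) v j xs →
           {_ : T (j ≤ᵇ k)} → Run f vs v (loop k (xs ++ ys) r)
run-exit {xs} {j = j} {k} {ys} {r} e {j≤k} = run e (≤-trans
  (+-mono-≤ (≤ᵇ⇒≤ j k j≤k) (≤-trans (m≤m+n (sum xs) (sum ys)) (≤-reflexive (sym (sum-++ xs ys)))))
  (loop-once k (xs ++ ys) r))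

-- For a recursive call that comes last in the order of evaluation; `run-first` is for one that
-- comes first.
run-last : ∀ {f vs v j k r} xs → Eval vs (bodies f) v j (xs ++ loop k xs r ∷ []) →
           {_ : T (j ≤ᵇ k)} → Run f vs v (loop k xs (suc r))
run-last {j = j} {k} {r} xs e {j≤k} = run e (begin
  j + sum (xs ++ F ∷ [])  ≡⟨ cong (j +_) (sum-++ xs (F ∷ [])) ⟩
  j + (sum xs + (F + 0))  ≡⟨ cong (λ z → j + (sum xs + z)) (+-identityʳ F) ⟩
  j + (sum xs + F)        ≡⟨ +-assoc j (sum xs) F ⟨
  (j + sum xs) + F        ≤⟨ +-monoˡ-≤ F (+-monoˡ-≤ (sum xs) (≤ᵇ⇒≤ j k j≤k)) ⟩
  (k + sum xs) + F        ≡⟨ loop-suc k xs r ⟩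
  loop k xs (suc r)       ∎)
  where
  open ≤-Reasoning
  F = loop k xs r

run-first : ∀ {f vs v j k r} → Eval vs (bodies f) v j (loop k xs r ∷ xs) →
            {_ : T (j ≤ᵇ k)} → Run f vs v (loop k xs (suc r))
run-first {xs} {j = j} {k} {r} e {j≤k} = run e (begin
  j + (F + sum xs)   ≡⟨ cong (j +_) (+-comm F (sum xs)) ⟩
  j + (sum xs + F)   ≡⟨ +-assoc j (sum xs) F ⟨
  (j + sum xs) + F   ≤⟨ +-monoˡ-≤ F (+-monoˡ-≤ (sum xs) (≤ᵇ⇒≤ j k j≤k)) ⟩
  (k + sum xs) + F   ≡⟨ loop-suc k xs r ⟩
  loop k xs (suc r)  ∎)
  where
  open ≤-Reasoning
  F = loop k xs r

-- Encodings and running times of the functions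

encodeLoads : Vec ℕ m → Tree
encodeLoads L = encodeList (map encodeℕ (Vec.toList L))

encodeVertex : Fin m → Tree
encodeVertex v = encodeℕ (toℕ v)

encodeUnit : Unit m → Tree
encodeUnit (e , i) = encodeSubset e ∙ encodeVertex i

encodeUnits : List (Unit m) → Tree
encodeUnits us = encodeList (map encodeUnit us)

encodeEdges : List (Subset m) → Tree
encodeEdges es = encodeList (map encodeSubset es)

encodeMaybe : Maybe (Fin m) → Tree
encodeMaybe nothing  = nil
encodeMaybe (just v) = nil ∙ encodeVertex v

-- The numerals bound, for every branch, the rules applied in one round outside the bodies of called
-- functions.
ltTime lookupTime incTime : ℕ → ℕ
ltTime     = loop 7 []
lookupTime = loop 7 []
incTime    = loop 9 []

findTime loadsTime stepTime improveTime initialTime insertTime sortTime : ℕ → ℕ → ℕ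
findTime n x = loop 22 (ltTime x ∷ []) n
loadsTime n l = loop 10 (incTime n ∷ []) l
stepTime n l = loop 17 (lookupTime n ∷ findTime n l ∷ []) l
improveTime n l = loop 12 (loadsTime n l ∷ stepTime n l ∷ []) (l * l)
initialTime n l = loop 25 (findTime n 2 ∷ []) l
insertTime n l = loop 20 (lookupTime n ∷ lookupTime n ∷ ltTime (suc l) ∷ []) n
sortTime n l = loop 11 (insertTime n l ∷ []) n

appendTime : ℕ → ℕ
appendTime = loop 7 []

copiesTime : ℕ → ℕ → ℕ
copiesTime r l = loop 8 (appendTime l ∷ []) r

eval-vars₂ : ∀ {Γ} {ρ : Vec Tree Γ} i j →
  Eval* ρ (var i ∷ var j ∷ []) (lookup ρ i ∷ lookup ρ j ∷ []) 2 []
eval-vars₂ i j = eval-var i ∷ᵉ eval-var j ∷ᵉ eval-[]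

eval-vars₃ : ∀ {Γ} {ρ : Vec Tree Γ} i j k →
  Eval* ρ (var i ∷ var j ∷ var k ∷ []) (lookup ρ i ∷ lookup ρ j ∷ lookup ρ k ∷ []) 3 []
eval-vars₃ i j k = eval-var i ∷ᵉ eval-vars₂ j k

-- The second argument is matched first, so the depth of the recursion is at most `b` for every `a`.
run-lt : ∀ a b → Run ltᶠ (encodeℕ a ∷ encodeℕ b ∷ []) (encodeBool (a <ᵇ b)) (ltTime b)
run-lt a zero = run-exit (eval-match-nil (eval-var 1F) eval-nil)
run-lt zero (suc b) = run-exit
  (eval-match-cons (eval-var 1F) (eval-match-nil (eval-var 2F) (eval-cons eval-nil eval-nil)))
run-lt (suc a) (suc b) = run-last []
  (eval-match-cons (eval-var 1F) (eval-match-cons (eval-var 2F)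
    (eval-call (eval-vars₂ 1F 3F) (run-lt a b))))

run-lookup : ∀ (L : Vec ℕ m) i →
  Run lookupᶠ (encodeLoads L ∷ encodeVertex i ∷ []) (encodeℕ (lookup L i)) (lookupTime m)
run-lookup {suc m} (l ∷ L) zero = run-exit
  (eval-match-cons (eval-var 0F) (eval-match-nil (eval-var 3F) (eval-var 0F)))
run-lookup {suc m} (l ∷ L) (suc i) = run-last []
  (eval-match-cons (eval-var 0F) (eval-match-cons (eval-var 3F)
    (eval-call (eval-vars₂ 3F 1F) (run-lookup L i))))

run-inc : ∀ (L : Vec ℕ m) i →
  Run incᶠ (encodeLoads L ∷ encodeVertex i ∷ []) (encodeLoads (inc L i)) (incTime m)
run-inc {suc m} (l ∷ L) zero = run-exit
  (eval-match-cons (eval-var 0F) (eval-match-nil (eval-var 3F)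
    (eval-cons (eval-cons eval-nil (eval-var 0F)) (eval-var 1F))))
run-inc {suc m} (l ∷ L) (suc i) = run-last []
  (eval-match-cons (eval-var 0F) (eval-match-cons (eval-var 3F)
    (eval-cons (eval-var 2F) (eval-call (eval-vars₂ 3F 1F) (run-inc L i)))))

run-find : ∀ (e : Subset m) L x →
  Run findᶠ (encodeSubset e ∷ encodeLoads L ∷ encodeℕ x ∷ []) (encodeMaybe (find e L x))
      (findTime m x)
run-find []          []      x = run-exit (eval-match-nil (eval-var 0F) eval-nil)
run-find (false ∷ e) (l ∷ L) x with find e L x | run-find e L x
... | nothing | r = run-last (ltTime x ∷ [])
  (eval-match-cons (eval-var 0F) (eval-match-cons (eval-var 3F)
    (eval-match-nil (eval-pad (ltTime x ∷ []) (eval-match-nil (eval-var 2F) eval-nil))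
      (eval-match-nil (eval-call (eval-vars₃ 3F 1F 6F) r) eval-nil))))
... | just j | r = run-last (ltTime x ∷ [])
  (eval-match-cons (eval-var 0F) (eval-match-cons (eval-var 3F)
    (eval-match-nil (eval-pad (ltTime x ∷ []) (eval-match-nil (eval-var 2F) eval-nil))
      (eval-match-cons (eval-call (eval-vars₃ 3F 1F 6F) r)
        (eval-cons eval-nil (eval-cons eval-nil (eval-var 1F)))))))
run-find (true ∷ e) (l ∷ L) x with suc l <ᵇ x | run-lt (suc l) x | find e L x | run-find e L x
... | true | s | _ | _ = run-exit
  (eval-match-cons (eval-var 0F) (eval-match-cons (eval-var 3F)
    (eval-match-cons (eval-match-cons (eval-var 2F)
        (eval-call (eval-cons eval-nil (eval-var 2F) ∷ᵉ eval-var 8F ∷ᵉ eval-[]) s))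
      (eval-cons eval-nil eval-nil))))
... | false | s | nothing | r = run-last (ltTime x ∷ [])
  (eval-match-cons (eval-var 0F) (eval-match-cons (eval-var 3F)
    (eval-match-nil (eval-match-cons (eval-var 2F)
        (eval-call (eval-cons eval-nil (eval-var 2F) ∷ᵉ eval-var 8F ∷ᵉ eval-[]) s))
      (eval-match-nil (eval-call (eval-vars₃ 3F 1F 6F) r) eval-nil))))
... | false | s | just j | r = run-last (ltTime x ∷ [])
  (eval-match-cons (eval-var 0F) (eval-match-cons (eval-var 3F)
    (eval-match-nil (eval-match-cons (eval-var 2F)
        (eval-call (eval-cons eval-nil (eval-var 2F) ∷ᵉ eval-var 8F ∷ᵉ eval-[]) s))
      (eval-match-cons (eval-call (eval-vars₃ 3F 1F 6F) r)
        (eval-cons eval-nil (eval-cons eval-nil (eval-var 1F)))))))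

-- Since `nil` encodes 0, the unary vertex count of the input doubles as the load vector of no
-- units.
encodeLoads-zeros : ∀ m → encodeLoads (replicate m 0) ≡ encodeℕ m
encodeLoads-zeros zero    = refl
encodeLoads-zeros (suc m) = cong (nil ∙_) (encodeLoads-zeros m)

run-loads : ∀ (us : List (Unit m)) →
  Run loadsᶠ (encodeUnits us ∷ encodeℕ m ∷ []) (encodeLoads (loads us)) (loadsTime m (length us))
run-loads {m} [] = subst (λ z → Run loadsᶠ (nil ∷ encodeℕ m ∷ []) z (loadsTime m 0))
  (sym (encodeLoads-zeros m)) (run-exit (eval-match-nil (eval-var 0F) (eval-var 1F)))
run-loads ((e , i) ∷ us) = run-first
  (eval-match-cons (eval-var 0F) (eval-match-cons (eval-var 0F)
    (eval-call (eval-call (eval-vars₂ 3F 5F) (run-loads us) ∷ᵉ eval-var 1F ∷ᵉ eval-[])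
               (run-inc (loads us) i))))

findTime-mono : ∀ m {x y} → x ≤ y → findTime m x ≤ findTime m y
findTime-mono m {x} {y} x≤y = begin
  findTime m x ≡⟨ loop-unfold 22 (ltTime x ∷ []) m ⟩
  _            ≤⟨ *-monoʳ-≤ (suc m) (+-monoʳ-≤ 22 (+-monoˡ-≤ 0 (loop-mono 7 [] x≤y))) ⟩
  _            ≡⟨ loop-unfold 22 (ltTime y ∷ []) m ⟨
  findTime m y ∎
  where open ≤-Reasoning

-- The threshold handed to `findᶠ` is a load, so a common bound `B` on the loads gives every
-- iteration the same cost bound.
run-step : ∀ (L : Vec ℕ m) {B} → (∀ v → lookup L v ≤ B) → ∀ us →
  Run stepᶠ (encodeUnits us ∷ encodeLoads L ∷ []) (encodeUnits (step L us))
      (loop 17 (lookupTime m ∷ findTime m B ∷ []) (length us))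
run-step L L≤B [] = run-exit (eval-match-nil (eval-var 0F) eval-nil)
run-step {m} L {B} L≤B ((e , i) ∷ us)
  with find e L (lookup L i) | weaken (findTime-mono m (L≤B i)) (run-find e L (lookup L i))
... | just j | r = run-exit
  (eval-match-cons (eval-var 0F) (eval-match-cons (eval-var 0F)
    (eval-match-cons
      (eval-call (eval-var 0F ∷ᵉ eval-var 5F ∷ᵉ
                  eval-call (eval-vars₂ 5F 1F) (run-lookup L i) ∷ᵉ eval-[]) r)
      (eval-cons (eval-cons (eval-var 2F) (eval-var 1F)) (eval-var 5F)))))
... | nothing | r = run-last (lookupTime m ∷ findTime m B ∷ [])
  (eval-match-cons (eval-var 0F) (eval-match-cons (eval-var 0F)
    (eval-match-nil
      (eval-call (eval-var 0F ∷ᵉ eval-var 5F ∷ᵉ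
                  eval-call (eval-vars₂ 5F 1F) (run-lookup L i) ∷ᵉ eval-[]) r)
      (eval-cons (eval-var 2F) (eval-call (eval-vars₂ 3F 5F) (run-step L L≤B us))))))

step-length : ∀ L (us : List (Unit m)) → length (step L us) ≡ length us
step-length L us = trans (sym (length-map proj₁ (step L us)))
  (trans (cong length (step-edges L us)) (length-map proj₁ us))

improve-length : ∀ k (us : List (Unit m)) → length (improve k us) ≡ length us
improve-length k us = trans (sym (length-map proj₁ (improve k us)))
  (trans (cong length (improve-edges k us)) (length-map proj₁ us))

-- Moves preserve the number `l` of units, so one bound serves all rounds.
run-improve : ∀ (fuel : List Tree) (us : List (Unit m)) {l} → length us ≡ l →
  Run improveᶠ (encodeList fuel ∷ encodeUnits us ∷ encodeℕ m ∷ [])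
      (encodeUnits (improve (length fuel) us))
      (loop 12 (loadsTime m l ∷ stepTime m l ∷ []) (length fuel))
run-improve [] us len = run-exit (eval-match-nil (eval-var 0F) (eval-var 1F))
run-improve {m} (x ∷ fuel) us refl = run-last (loadsTime m (length us) ∷ stepTime m (length us) ∷ [])
  (eval-match-cons (eval-var 0F)
    (eval-call (eval-var 1F ∷ᵉ
      eval-call (eval-var 3F ∷ᵉ eval-call (eval-vars₂ 3F 4F) (run-loads us) ∷ᵉ eval-[])
                (run-step (loads us) (load≤length us) us) ∷ᵉ
      eval-var 4F ∷ᵉ eval-[])
      (run-improve fuel (step (loads us) us) (step-length (loads us) us))))

run-append : ∀ xs ys → Run appendᶠ (encodeList xs ∷ encodeList ys ∷ [])
                           (encodeList (xs ++ ys)) (appendTime (length xs))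
run-append []       ys = run-exit (eval-match-nil (eval-var 0F) (eval-var 1F))
run-append (x ∷ xs) ys = run-last []
  (eval-match-cons (eval-var 0F)
    (eval-cons (eval-var 0F) (eval-call (eval-vars₂ 1F 3F) (run-append xs ys))))

run-copies : ∀ (xs ys : List Tree) → Run copiesᶠ (encodeList xs ∷ encodeList ys ∷ [])
                           (encodeList (copies xs ys)) (copiesTime (length xs) (length ys))
run-copies []       ys = run-exit (eval-match-nil (eval-var 0F) eval-nil)
run-copies (x ∷ xs) ys = run-first
  (eval-match-cons (eval-var 0F)
    (eval-call (eval-var 3F ∷ᵉ eval-call (eval-vars₂ 1F 3F) (run-copies xs ys) ∷ᵉ eval-[])
               (run-append ys (copies xs ys))))

run-initial : ∀ (es : List (Subset m)) →
  Run initialᶠ (encodeEdges es ∷ encodeℕ m ∷ []) (encodeUnits (initial es)) (initialTime m (length es))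
run-initial [] = run-exit (eval-match-nil (eval-var 0F) eval-nil)
run-initial {m} (e ∷ es)
  with find e (replicate m 0) 2
     | subst (λ z → Run findᶠ (encodeSubset e ∷ z ∷ encodeℕ 2 ∷ [])
                        (encodeMaybe (find e (replicate m 0) 2)) (findTime m 2))
             (encodeLoads-zeros m) (run-find e (replicate m 0) 2)
... | just j | r = run-last (findTime m 2 ∷ [])
  (eval-match-cons (eval-var 0F)
    (eval-match-cons
      (eval-call (eval-var 0F ∷ᵉ eval-var 3F ∷ᵉ
                  eval-cons eval-nil (eval-cons eval-nil eval-nil) ∷ᵉ eval-[]) r)
      (eval-cons (eval-cons (eval-var 2F) (eval-var 1F))
                 (eval-call (eval-vars₂ 3F 5F) (run-initial es)))))
... | nothing | r = run-last (findTime m 2 ∷ [])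
  (eval-match-cons (eval-var 0F)
    (eval-match-nil
      (eval-call (eval-var 0F ∷ᵉ eval-var 3F ∷ᵉ
                  eval-cons eval-nil (eval-cons eval-nil eval-nil) ∷ᵉ eval-[]) r)
      (eval-call (eval-vars₂ 1F 3F) (run-initial es))))

encodeVertices : List (Fin m) → Tree
encodeVertices vs = encodeList (map encodeVertex vs)

≤ᵇ≡<ᵇsuc : ∀ a b → (a ≤ᵇ b) ≡ (a <ᵇ suc b)
≤ᵇ≡<ᵇsuc zero    b = refl
≤ᵇ≡<ᵇsuc (suc a) b = refl

module _ (L : Vec ℕ m) {B} (L≤B : ∀ v → lookup L v ≤ B) where

  insertParts : List ℕ
  insertParts = lookupTime m ∷ lookupTime m ∷ ltTime (suc B) ∷ []

  run-insert : ∀ v ws →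
    Run insertᶠ (encodeLoads L ∷ encodeVertex v ∷ encodeVertices ws ∷ [])
        (encodeVertices (Insertion.insert (byLoad L) v ws))
        (loop 20 insertParts (length ws))
  run-insert v [] = run-exit (eval-match-nil (eval-var 2F) (eval-cons (eval-var 1F) eval-nil))
  run-insert v (w ∷ ws)
    -- In the reversed order the insertion test is this comparison; `insertᶠ` performs it as a
    -- strict comparison with the successor.
    with lookup L w ≤ᵇ lookup L v
       | subst (λ b → Run ltᶠ (encodeℕ (lookup L w) ∷ encodeℕ (suc (lookup L v)) ∷ [])
                            (encodeBool b) (ltTime (suc B)))
               (sym (≤ᵇ≡<ᵇsuc (lookup L w) (lookup L v)))
               (weaken (loop-mono 7 [] (s≤s (L≤B v))) (run-lt (lookup L w) (suc (lookup L v))))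
  ... | true | r = run-exit
    (eval-match-cons (eval-var 2F)
      (eval-match-cons
        (eval-call (eval-call (eval-vars₂ 2F 0F) (run-lookup L w) ∷ᵉ
                    eval-cons eval-nil (eval-call (eval-vars₂ 2F 3F) (run-lookup L v)) ∷ᵉ eval-[]) r)
        (eval-cons (eval-var 5F) (eval-var 6F))))
  ... | false | r = run-last insertParts
    (eval-match-cons (eval-var 2F)
      (eval-match-nil
        (eval-call (eval-call (eval-vars₂ 2F 0F) (run-lookup L w) ∷ᵉ
                    eval-cons eval-nil (eval-call (eval-vars₂ 2F 3F) (run-lookup L v)) ∷ᵉ eval-[]) r)
        (eval-cons (eval-var 0F) (eval-call (eval-vars₃ 2F 3F 1F) (run-insert v ws)))))

  -- Generalised from `allFin m` to `k` consecutive vertices starting at `i`, as the recursion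
  -- requires; `k ≤ m` bounds the length of the lists inserted into.
  run-sort : ∀ {k i} (f : Fin k → Fin m) → (∀ j → i + toℕ j ≡ toℕ (f j)) → k ≤ m →
    Run sortᶠ (encodeLoads L ∷ encodeℕ k ∷ encodeℕ i ∷ [])
        (encodeVertices (Insertion.sort (byLoad L) (tabulate f)))
        (loop 11 (loop 20 insertParts m ∷ []) k)
  run-sort {zero} f shift k≤m = run-exit (eval-match-nil (eval-var 1F) eval-nil)
  run-sort {suc k} {i} f shift k≤m = run-first
    (eval-match-cons (eval-var 1F)
      (eval-call (eval-var 2F ∷ᵉ eval-var 4F ∷ᵉ
                  eval-call (eval-var 2F ∷ᵉ eval-var 1F ∷ᵉ eval-cons eval-nil (eval-var 4F) ∷ᵉ eval-[])
                    (run-sort (f ∘ suc) (λ j → trans (sym (+-suc i (toℕ j))) (shift (suc j))) (<⇒≤ k≤m))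
                  ∷ᵉ eval-[])
        (subst (λ j → Run insertᶠ (encodeLoads L ∷ encodeℕ j ∷ encodeVertices ws ∷ []) _ _)
               (trans (sym (shift zero)) (+-identityʳ i))
               (weaken (loop-mono 20 insertParts length≤) (run-insert (f zero) ws)))))
    where
    ws = Insertion.sort (byLoad L) (tabulate (f ∘ suc))
    length≤ : length ws ≤ m
    length≤ = ≤-trans (≤-reflexive (trans
      (↭-length (InsertionProperties.sort-↭ (byLoad L) (tabulate (f ∘ suc))))
      (length-tabulate (f ∘ suc)))) (<⇒≤ k≤m)

  run-sortAll : Run sortᶠ (encodeLoads L ∷ encodeℕ m ∷ nil ∷ [])
                    (encodeOrdering (loadOrdering L)) (sortTime m B)
  run-sortAll = subst (λ z → Run sortᶠ (encodeLoads L ∷ encodeℕ m ∷ nil ∷ []) z (sortTime m B))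
    (cong encodeList (trans (cong (map encodeVertex) (sym (loadOrdering-tabulate L)))
                            (map-tabulate (loadOrdering L ⟨$⟩ʳ_) encodeVertex)))
    (run-sort id (λ j → refl) ≤-refl)

-- Approximation ratio and polynomial time

map-copies : ∀ {A B C : Set} (f : B → C) (xs : List A) ys →
             map f (copies xs ys) ≡ copies xs (map f ys)
map-copies f []       ys = refl
map-copies f (x ∷ xs) ys = trans (map-++ f ys _) (cong (map f ys ++_) (map-copies f xs ys))

module _ (H : Hypergraph) where

  -- Of vertexList, vertexPairs and fuel only the lengths matter: they are n, n²
  -- and the square of the number of units, which bounds the number of moves.
  vertexList : List Tree
  vertexList = List.replicate (n H) nil

  vertexPairs : List Tree
  vertexPairs = copies vertexList vertexList

  fractions : List (Subset (n H))
  fractions = copies vertexPairs (edges H)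

  initialUnits : List (Unit (n H))
  initialUnits = initial fractions

  fuel : List Tree
  fuel = copies (map encodeUnit initialUnits) (map encodeUnit initialUnits)

  finalUnits : List (Unit (n H))
  finalUnits = improve (length fuel) initialUnits

  output : Ordering (n H)
  output = loadOrdering (loads finalUnits)

  length-vertexPairs : length vertexPairs ≡ n H * n H
  length-vertexPairs = trans (length-copies vertexList vertexList)
    (cong₂ _*_ (length-replicate (n H)) (length-replicate (n H)))

  length-fractions : length fractions ≡ n H * n H * length (edges H)
  length-fractions = trans (length-copies vertexPairs (edges H))
    (cong (_* length (edges H)) length-vertexPairs)

  initialUnits-correct : map proj₁ initialUnits ≡ fractions × All Valid initialUnits
  initialUnits-correct = initial-correct (all-copies vertexPairs (nonempty H))

  finalUnits-edges : map proj₁ finalUnits ≡ fractions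
  finalUnits-edges = trans (improve-edges (length fuel) initialUnits) (proj₁ initialUnits-correct)

  length-initialUnits : length initialUnits ≡ n H * n H * length (edges H)
  length-initialUnits = trans (sym (length-map proj₁ initialUnits))
    (trans (cong length (proj₁ initialUnits-correct)) length-fractions)

  length-finalUnits : length finalUnits ≡ length initialUnits
  length-finalUnits = improve-length (length fuel) initialUnits

  length-fuel : length fuel ≡ length initialUnits * length initialUnits
  length-fuel = trans (length-copies (map encodeUnit initialUnits) (map encodeUnit initialUnits))
    (cong₂ _*_ (length-map encodeUnit initialUnits) (length-map encodeUnit initialUnits))

  finalUnits-settled : All (Settled (loads finalUnits)) finalUnits
  finalUnits-settled = improve-settled (length fuel) initialUnits
    (≤-trans (potential≤ initialUnits) (≤-reflexive (sym length-fuel)))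

  -- Moves change the charged vertices but not the edges, so each edge still occurs once for each of
  -- the n² copies.
  sum-fractions : ∀ π → sum (map (Cov π ∘ proj₁) finalUnits) ≡ n H * n H * latency H π
  sum-fractions π = begin
    sum (map (Cov π ∘ proj₁) finalUnits)     ≡⟨ cong sum (map-∘ finalUnits) ⟩
    sum (map (Cov π) (map proj₁ finalUnits)) ≡⟨ cong (sum ∘ map (Cov π)) finalUnits-edges ⟩
    sum (map (Cov π) fractions)              ≡⟨ sum-copies (Cov π) vertexPairs (edges H) ⟩
    length vertexPairs * latency H π         ≡⟨ cong (_* latency H π) length-vertexPairs ⟩
    n H * n H * latency H π                  ∎
    where open ≡-Reasoning

  scaledRatio : n H * n H ≤ length finalUnits →
                ∀ π → n H * n H * latency H output ≤ n H * n H * (2 * latency H π)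
  scaledRatio enough π = begin
    N * latency H output                          ≡⟨ sum-fractions output ⟨
    sum (map (Cov output ∘ proj₁) finalUnits)
      ≤⟨ coverRatio finalUnits (improve-valid (length fuel) (proj₂ initialUnits-correct))
           output (loadOrdering-sorted (loads finalUnits)) finalUnits-settled enough π ⟩
    2 * sum (map (Cov π ∘ proj₁) finalUnits)      ≡⟨ cong (2 *_) (sum-fractions π) ⟩
    2 * (N * latency H π)                         ≡⟨ *-assoc 2 N (latency H π) ⟨
    2 * N * latency H π                           ≡⟨ cong (_* latency H π) (*-comm 2 N) ⟩
    N * 2 * latency H π                           ≡⟨ *-assoc N 2 (latency H π) ⟩
    N * (2 * latency H π)                         ∎
    where
    open ≤-Reasoning
    N = n H * n H

-- Without edges the left side is 0, and a nonempty edge rules out an empty vertex set. Otherwise n²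
-- is positive and can be cancelled, and one edge already gives n² units.
output-ratio : ∀ H π → latency H (output H) ≤ 2 * latency H π
output-ratio record { edges = [] } π = z≤n
output-ratio record { n = zero ; edges = e ∷ es ; nonempty = (() , _) ∷ _ } π
output-ratio H@(record { n = suc k ; edges = e ∷ es }) π =
  *-cancelˡ-≤ (suc k * suc k) (scaledRatio H enough π)
  where
  enough : suc k * suc k ≤ length (finalUnits H)
  enough = ≤-trans (m≤m*n (suc k * suc k) (suc (length es)))
    (≤-reflexive (sym (trans (length-finalUnits H) (length-initialUnits H))))

output-optimal : ∀ H → latency H (output H) ≤ 2 * minLatency H
output-optimal H = subst (λ l → latency H (output H) ≤ 2 * l) (proj₂ attained)
                         (output-ratio H (proj₁ attained))
  where
  attained : ∃[ π ] latency H π ≡ minLatency H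
  attained = proj₁ (proj₂ (optimum H))

-- The bounds of the calls in `main` in order of evaluation, as functions of the hypergraph so that
-- each can be shown polynomial.
timeParts : List (Hypergraph → ℕ)
timeParts =
    (λ H → copiesTime (length (vertexList H)) (length (vertexList H)))
  ∷ (λ H → copiesTime (length (vertexPairs H)) (length (map encodeSubset (edges H))))
  ∷ (λ H → initialTime (n H) (length (fractions H)))
  ∷ (λ H → copiesTime (length (map encodeUnit (initialUnits H)))
                      (length (map encodeUnit (initialUnits H))))
  ∷ (λ H → loop 12 (loadsTime (n H) (length (initialUnits H)) ∷
                    stepTime (n H) (length (initialUnits H)) ∷ []) (length (fuel H)))
  ∷ (λ H → loadsTime (n H) (length (finalUnits H)))
  ∷ (λ H → sortTime (n H) (length (finalUnits H)))
  ∷ []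

run-main : ∀ H → Eval (encodeHypergraph H ∷ []) (Program.main program) (encodeOrdering (output H))
                      -- The 23 counts the rules applied in `main` itself, outside the bodies of the
                      -- functions it calls.
                      23 (map (λ f → f H) timeParts)
run-main H = eval-match-cons (eval-var 0F)
  (eval-let
    (eval-call
      (eval-call
        (eval-call (eval-vars₂ 0F 0F) (run-copies (vertexList H) (vertexList H)) ∷ᵉ
         eval-var 1F ∷ᵉ eval-[])
        (run-copies (vertexPairs H) (map encodeSubset (edges H))) ∷ᵉ eval-var 0F ∷ᵉ eval-[])
      (subst (λ es → Run initialᶠ (encodeList es ∷ encodeℕ (n H) ∷ []) (encodeUnits (initialUnits H))
                         (initialTime (n H) (length (fractions H))))
        (map-copies encodeSubset (vertexPairs H) (edges H)) (run-initial (fractions H))))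
    (eval-let
      (eval-call
        (eval-call
          (eval-call (eval-vars₂ 0F 0F)
            (run-copies (map encodeUnit (initialUnits H)) (map encodeUnit (initialUnits H))) ∷ᵉ
           eval-var 0F ∷ᵉ eval-var 1F ∷ᵉ eval-[])
          (run-improve (fuel H) (initialUnits H) refl) ∷ᵉ eval-var 1F ∷ᵉ eval-[])
        (run-loads (finalUnits H)))
      (eval-call (eval-var 0F ∷ᵉ eval-var 2F ∷ᵉ eval-nil ∷ᵉ eval-[])
        (run-sortAll (loads (finalUnits H)) (load≤length (finalUnits H))))))

-- Polynomial bounds in the input size

inputSize : Hypergraph → ℕ
inputSize H = size (encodeHypergraph H)

Polynomial : (Hypergraph → ℕ) → Set
Polynomial f = ∃[ c ] ∃[ d ] ∀ H → f H ≤ c * inputSize H ^ d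

poly-const : ∀ k → Polynomial (λ _ → k)
poly-const k = k , 0 , λ H → ≤-reflexive (sym (*-identityʳ k))

poly-size : ∀ {f} → (∀ H → f H ≤ inputSize H) → Polynomial f
poly-size f≤ = 1 , 1 , λ H → ≤-trans (f≤ H)
  (≤-reflexive (sym (trans (*-identityˡ _) (*-identityʳ _))))

poly-≡ : ∀ {f g} → (∀ H → f H ≡ g H) → Polynomial g → Polynomial f
poly-≡ f≡g (c , d , bound) = c , d , λ H → ≤-trans (≤-reflexive (f≡g H)) (bound H)

poly-+ : ∀ {f g} → Polynomial f → Polynomial g → Polynomial (λ H → f H + g H)
poly-+ {f} {g} (c , d , f≤) (c′ , d′ , g≤) = c + c′ , d + d′ , λ H →
  let s = inputSize H in begin
  f H + g H                             ≤⟨ +-mono-≤ (f≤ H) (g≤ H) ⟩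
  -- Both exponents can be raised to `d + d′` because the input size is at least 1.
  c * s ^ d + c′ * s ^ d′               ≤⟨ +-mono-≤ (*-monoʳ-≤ c (^-monoʳ-≤ s (m≤m+n d d′)))
                                                    (*-monoʳ-≤ c′ (^-monoʳ-≤ s (m≤n+m d′ d))) ⟩
  c * s ^ (d + d′) + c′ * s ^ (d + d′)  ≡⟨ *-distribʳ-+ (s ^ (d + d′)) c c′ ⟨
  (c + c′) * s ^ (d + d′)               ∎
  where open ≤-Reasoning

poly-* : ∀ {f g} → Polynomial f → Polynomial g → Polynomial (λ H → f H * g H)
poly-* {f} {g} (c , d , f≤) (c′ , d′ , g≤) = c * c′ , d + d′ , λ H →
  let s = inputSize H in begin
  f H * g H                    ≤⟨ *-mono-≤ (f≤ H) (g≤ H) ⟩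
  (c * s ^ d) * (c′ * s ^ d′)  ≡⟨ *-interchange c (s ^ d) c′ (s ^ d′) ⟩
  c * c′ * (s ^ d * s ^ d′)    ≡⟨ cong (c * c′ *_) (^-distribˡ-+-* s d d′) ⟨
  c * c′ * s ^ (d + d′)        ∎
  where open ≤-Reasoning

poly-sum : ∀ {fs : List (Hypergraph → ℕ)} → All Polynomial fs →
           Polynomial (λ H → sum (map (λ f → f H) fs))
poly-sum []       = poly-const 0
poly-sum (p ∷ ps) = poly-+ p (poly-sum ps)

poly-loop : ∀ k {fs r} → All Polynomial fs → Polynomial r →
            Polynomial (λ H → loop k (map (λ f → f H) fs) (r H))
poly-loop k ps p = poly-≡ (λ H → loop-unfold k _ _)
  (poly-* (poly-+ (poly-const 1) p) (poly-+ (poly-const k) (poly-sum ps)))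

size-encodeList : ∀ xs → length xs ≤ size (encodeList xs)
size-encodeList []       = z≤n
size-encodeList (x ∷ xs) = s≤s (≤-trans (size-encodeList xs) (m≤n+m _ (size x)))

-- The input contains the number of vertices in unary.
poly-n : Polynomial n
poly-n = poly-size λ H → ≤-trans (≤-reflexive (sym (length-replicate (n H))))
  (≤-trans (size-encodeList (vertexList H)) (≤-trans (m≤m+n _ _) (n≤1+n _)))

poly-edges : Polynomial (length ∘ edges)
poly-edges = poly-size λ H → ≤-trans (≤-reflexive (sym (length-map encodeSubset (edges H))))
  (≤-trans (size-encodeList (map encodeSubset (edges H)))
    (≤-trans (m≤n+m _ (size (encodeℕ (n H)))) (n≤1+n _)))

poly-timeParts : All Polynomial timeParts
poly-timeParts =
    copies′ vertices vertices
  ∷ copies′ (poly-≡ length-vertexPairs (poly-* poly-n poly-n))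
            (poly-≡ (λ H → length-map encodeSubset (edges H)) poly-edges)
  ∷ poly-loop 25 (find′ (poly-const 2) ∷ []) (poly-≡ length-fractions cube)
  ∷ copies′ encoded encoded
  ∷ poly-loop 12 (loads′ units ∷ poly-loop 17 (poly-loop 7 [] poly-n ∷ find′ units ∷ []) units ∷ [])
                 (poly-≡ length-fuel (poly-* units units))
  ∷ loads′ final
  ∷ poly-loop 11 (poly-loop 20 (poly-loop 7 [] poly-n ∷ poly-loop 7 [] poly-n ∷
                                poly-loop 7 [] (poly-+ (poly-const 1) final) ∷ []) poly-n ∷ []) poly-n
  ∷ []
  where
  vertices : Polynomial (length ∘ vertexList)
  vertices = poly-≡ (λ H → length-replicate (n H)) poly-n

  cube : Polynomial (λ H → n H * n H * length (edges H))
  cube = poly-* (poly-* poly-n poly-n) poly-edges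

  units : Polynomial (length ∘ initialUnits)
  units = poly-≡ length-initialUnits cube

  encoded : Polynomial (λ H → length (map encodeUnit (initialUnits H)))
  encoded = poly-≡ (λ H → length-map encodeUnit (initialUnits H)) units

  final : Polynomial (length ∘ finalUnits)
  final = poly-≡ length-finalUnits units

  copies′ : ∀ {r l} → Polynomial r → Polynomial l → Polynomial (λ H → copiesTime (r H) (l H))
  copies′ p q = poly-loop 8 (poly-loop 7 [] q ∷ []) p

  find′ : ∀ {x} → Polynomial x → Polynomial (λ H → findTime (n H) (x H))
  find′ p = poly-loop 22 (poly-loop 7 [] p ∷ []) poly-n

  loads′ : ∀ {l} → Polynomial l → Polynomial (λ H → loadsTime (n H) (l H))
  loads′ p = poly-loop 10 (poly-loop 9 [] poly-n ∷ []) p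

abstract
  poly-time : Polynomial (λ H → 23 + sum (map (λ f → f H) timeParts))
  poly-time = poly-+ (poly-const 23) (poly-sum poly-timeParts)

-- The expectation and the final bound

½-double : ∀ q → ½ ℚ.* (q ℚ.+ q) ≡ q
½-double q = trans (ℚ.*-distribˡ-+ ½ q q)
  (trans (sym (ℚ.*-distribʳ-+ q ½ ½)) (ℚ.*-identityˡ q))

𝔼-const : ∀ k q → 𝔼 {k} (λ _ → q) ≡ q
𝔼-const zero    q = refl
𝔼-const (suc k) q = trans (cong (λ p → ½ ℚ.* (p ℚ.+ p)) (𝔼-const k q)) (½-double q)

-- Over unnormalised fractions with denominator 1 this is an inequality of numerators.
fromℕ-≤-* : ∀ {a} b c → a ≤ b * c → fromℕ a ℚ.≤ fromℕ b ℚ.* fromℕ c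
fromℕ-≤-* {a} b c a≤bc = ℚ.toℚᵘ-cancel-≤ (begin
  ℚ.toℚᵘ (fromℕ a)                       ≃⟨ unnormalise a ⟩
  mkℚᵘ (ℤ.+ a) 0                         ≤⟨ *≤* numerators ⟩
  mkℚᵘ (ℤ.+ b) 0 ℚᵘ.* mkℚᵘ (ℤ.+ c) 0     ≃⟨ ℚᵘ.*-cong (unnormalise b) (unnormalise c) ⟨
  ℚ.toℚᵘ (fromℕ b) ℚᵘ.* ℚ.toℚᵘ (fromℕ c) ≃⟨ ℚ.toℚᵘ-homo-* (fromℕ b) (fromℕ c) ⟨
  ℚ.toℚᵘ (fromℕ b ℚ.* fromℕ c)           ∎)
  where
  open ℚᵘ.≤-Reasoning
  unnormalise : ∀ k → ℚ.toℚᵘ (fromℕ k) ℚᵘ.≃ mkℚᵘ (ℤ.+ k) 0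
  unnormalise k = ℚ.toℚᵘ-fromℚᵘ (mkℚᵘ (ℤ.+ k) 0)

  numerators : ℤ.+ a ℤ.* ℤ.+ 1 ℤ.≤ ℤ.+ b ℤ.* ℤ.+ c ℤ.* ℤ.+ 1
  numerators = subst₂ ℤ._≤_ (sym (ℤ.*-identityʳ (ℤ.+ a)))
    (trans (ℤ.pos-* b c) (sym (ℤ.*-identityʳ (ℤ.+ b ℤ.* ℤ.+ c)))) (ℤ.+≤+ a≤bc)

theorem1p2 : Σ[ P ∈ Program ] IsRandomizedPolytimeApproximation (fromℕ 2) P
theorem1p2 = program , coeff , degree , λ H →
    -- The algorithm is deterministic: all flips give the same ordering, and the expectation is that
    -- of a constant.
    (λ _ → output H)
  , (λ ω → let t , t≤ , p = Eval.derive (run-main H) (Vec.toList ω)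
           in t , Vec.toList ω , ≤-trans (≤-trans t≤ (time≤ H)) (m≤m+n _ coeff) , p)
  , subst (ℚ._≤ fromℕ 2 ℚ.* fromℕ (minLatency H))
          (sym (𝔼-const (coeff * inputSize H ^ degree + coeff) (fromℕ (latency H (output H)))))
          (fromℕ-≤-* 2 (minLatency H) (output-optimal H))
  where
  coeff = proj₁ poly-time
  degree = proj₁ (proj₂ poly-time)
  time≤ = proj₂ (proj₂ poly-time)
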